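{- Suppose $np \to \infty$ and $d < 0.99n$. Then there is a $d$-dependent random graph distribution $G_{n,p,d}$ such that, for $G$ drawn from it, almost surely there are sets of vertices $A$ and $B$ where \[ e(A,B) - p|A||B| > (1-o(1))(1-p)\sqrt{1-d/n}\,\sqrt{|A||B|\,np\,(d+1)}. \]
   Context: A dependency graph for a set of random variables $X_1,\ldots,X_m$ is a graph whose vertices correspond to the random variables and whose edges correspond to dependencies: each $X_i$ is independent of the collection of all other $X_j$ except those for which $(i,j)$ is an edge (the notion used in the Lovász local lemma and Janson's inequality). The variables are $d$-locally dependent if they have a dependency graph of maximum degree at most $d$. A $d$-dependent random graph distribution $G_{n,p,d}$ is any random graph distribution on $n$ vertices in which each edge is present with probability $p$ and the edges (that is, their indicator variables) are $d$-locally dependent. The parameters $p$ and $d$ may depend on $n$. An event happens almost surely if its probability tends to $1$ as $n\to\infty$, and $o(1)$ denotes a quantity tending to $0$ as $n\to\infty$. For sets of vertices $A,B$ (not necessarily disjoint), $e(A,B)$ counts the number of edges of $G$ having one endpoint in $A$ and the other in $B$, with edges contained in $A\cap B$ counted twice.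
   Formalization: The formal statement additionally assumes p < 1 for every n: for p = 1 the graph is complete, so e(A,B) − p|A||B| = −|A∩B| ≤ 0 while the right side is 0, and the strict inequality fails. -}

module Defs where

open import Algebra.Bundles.Raw using (RawMonoid)
open import Data.Bool using (Bool; true; false; if_then_else_)
import Data.Bool as Bool
open import Data.Fin using (Fin)
import Data.Fin as Fin
open import Data.Fin.Properties using (all?)
open import Data.Fin.Subset using (Subset; _∈_)
import Data.Fin.Subset as Subset
open import Data.Fin.Subset.Properties using (_∈?_)
open import Data.List using (List; length; filter; cartesianProduct; allFin; lookup)
open import Data.Vec using (tabulate)
open import Level using (0ℓ)
open import Relation.Nullary.Decidable using (_×-dec_; _→-dec_)
open import Relation.Unary using (Decidable)
open import Data.Nat using (ℕ; zero; suc; NonZero)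
import Data.Nat as ℕ
import Data.Nat.Properties as ℕ
open import Data.Integer using (+_)
import Data.Integer as ℤ
import Data.Integer.Properties as ℤ
open import Data.Integer.Solver using () renaming (module +-*-Solver to ℤ-Solver)
open import Data.Product using (Σ-syntax; _×_; _,_; proj₁; proj₂)
open import Data.Rational using (ℚ; 0ℚ; 1ℚ; ½)
import Data.Rational as ℚ
import Data.Rational.Properties as ℚ
import Data.Rational.Unnormalised as ℚᵘ
import Data.Rational.Unnormalised.Properties as ℚᵘ
open import Data.Sum using (_⊎_; inj₁; inj₂)
open import Relation.Binary.PropositionalEquality
  using (_≡_; _≢_; refl; sym; trans; cong; cong₂; subst)
open import Relation.Nullary using (yes; no; does; ¬?; contradiction)

Eventually : (ℕ → Set) → Set
Eventually P = Σ[ N ∈ ℕ ] (∀ n → N ℕ.≤ n → P n)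

module RationalLemmas where

  open import Data.Rational
  open import Data.Rational.Properties
  open import Data.Rational.Solver using (module +-*-Solver)
  open +-*-Solver using (solve; _:=_; _:+_; _:*_; _:-_; :-_; con)
  open ≤-Reasoning

  -- Opaque because unfolding the reduction to lowest terms is expensive.
  opaque
    grid : ℕ → ℕ → ℚ
    grid k j = + j / suc k

    grid-zero : ∀ k → grid k 0 ≡ 0ℚ
    grid-zero k = 0/n≡0 (suc k)

    grid-toℚᵘ : ∀ k j → toℚᵘ (grid k j) ℚᵘ.≃ ℚᵘ.mkℚᵘ (+ j) k
    grid-toℚᵘ k j = toℚᵘ-fromℚᵘ (ℚᵘ.mkℚᵘ (+ j) k)

  unit : ℕ → ℚ
  unit k = grid k 1

  0<half : ∀ {ε} → 0ℚ < ε → 0ℚ < ½ * ε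
  0<half {ε} h = positive⁻¹ (½ * ε) {{pos*pos⇒pos ½ ε {{positive h}}}}

  half+half : ∀ ε → ½ * ε + ½ * ε ≡ ε
  half+half ε = trans (sym (*-distribʳ-+ ε ½ ½)) (*-identityˡ ε)

  *-mono-≤ : ∀ {a b c d} → 0ℚ ≤ a → 0ℚ ≤ d → a ≤ b → c ≤ d → a * c ≤ b * d
  *-mono-≤ {a} {b} {c} {d} 0≤a 0≤d a≤b c≤d = ≤-trans
    (*-monoˡ-≤-nonNeg a {{nonNegative 0≤a}} c≤d)
    (*-monoʳ-≤-nonNeg d {{nonNegative 0≤d}} a≤b)

  p≤∣p∣ : ∀ p → p ≤ ∣ p ∣
  p≤∣p∣ p with ≤-total 0ℚ p
  ... | inj₁ h = ≤-reflexive (sym (0≤p⇒∣p∣≡p h))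
  ... | inj₂ h = ≤-trans h (0≤∣p∣ p)

  ∣p-q∣≤r⇒p≤q+r : ∀ {p q r} → ∣ p - q ∣ ≤ r → p ≤ q + r
  ∣p-q∣≤r⇒p≤q+r {p} {q} {r} h = begin
    p            ≡⟨ solve 2 (λ p q → p := q :+ (p :- q)) refl p q ⟩
    q + (p - q)  ≤⟨ +-monoʳ-≤ q (≤-trans (p≤∣p∣ (p - q)) h) ⟩
    q + r        ∎

  p≤q+r⇒p-q≤r : ∀ {p q r} → p ≤ q + r → p - q ≤ r
  p≤q+r⇒p-q≤r {p} {q} {r} h = begin
    p - q        ≤⟨ +-monoˡ-≤ (- q) h ⟩
    (q + r) - q  ≡⟨ solve 2 (λ q r → (q :+ r) :- q := r) refl q r ⟩
    r            ∎

  close : ∀ {p q r} → p ≤ q + r → q ≤ p + r → ∣ p - q ∣ ≤ r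
  close {p} {q} {r} h k with ∣p∣≡p∨∣p∣≡-p (p - q)
  ... | inj₁ e = ≤-trans (≤-reflexive e) (p≤q+r⇒p-q≤r h)
  ... | inj₂ e = ≤-trans
    (≤-reflexive (trans e (solve 2 (λ p q → :- (p :- q) := q :- p) refl p q)))
    (p≤q+r⇒p-q≤r k)

  ∣p∣≤∣q∣+∣p-q∣ : ∀ p q → ∣ p ∣ ≤ ∣ q ∣ + ∣ p - q ∣
  ∣p∣≤∣q∣+∣p-q∣ p q = begin
    ∣ p ∣              ≡⟨ cong ∣_∣ (solve 2 (λ p q → p := q :+ (p :- q)) refl p q) ⟩
    ∣ q + (p - q) ∣    ≤⟨ ∣p+q∣≤∣p∣+∣q∣ q (p - q) ⟩
    ∣ q ∣ + ∣ p - q ∣  ∎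

  -- The quotient of ε by b.
  scale : (b : ℚ) → 0ℚ < b → ∀ ε → 0ℚ < ε → Σ[ δ ∈ ℚ ] (0ℚ < δ × b * δ ≡ ε)
  scale b 0<b ε 0<ε = (1/ b) * ε , positive⁻¹ _ {{pos*pos⇒pos (1/ b) ε}} , eq
    where
    instance
      b-pos : Positive b
      b-pos = positive 0<b
      ε-pos : Positive ε
      ε-pos = positive 0<ε
      b-nonZero : ℚ.NonZero b
      b-nonZero = pos⇒nonZero b
      1/b-pos : Positive (1/ b)
      1/b-pos = 1/pos⇒pos b
    eq : b * ((1/ b) * ε) ≡ ε
    eq = trans (sym (*-assoc b (1/ b) ε))
               (trans (cong (_* ε) (*-inverseʳ b)) (*-identityˡ ε))

  grid-suc : ∀ k j → grid k (suc j) ≡ grid k j + unit k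
  grid-suc k j = toℚᵘ-injective (ℚᵘ.≃-trans (grid-toℚᵘ k (suc j)) (ℚᵘ.≃-trans (ℚᵘ.*≡* eq)
    (ℚᵘ.≃-sym (ℚᵘ.≃-trans (toℚᵘ-homo-+ (grid k j) (unit k))
                          (ℚᵘ.+-cong (grid-toℚᵘ k j) (grid-toℚᵘ k 1))))))
    where
    K = + suc k
    eq : + suc j ℤ.* (K ℤ.* K) ≡ (+ j ℤ.* K ℤ.+ + 1 ℤ.* K) ℤ.* K
    eq = ℤ-Solver.solve 2 (λ x y → (ℤ-Solver.con (+ 1) ℤ-Solver.:+ x) ℤ-Solver.:* (y ℤ-Solver.:* y)
           ℤ-Solver.:= (x ℤ-Solver.:* y ℤ-Solver.:+ ℤ-Solver.con (+ 1) ℤ-Solver.:* y) ℤ-Solver.:* y)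
           refl (+ j) K

  grid-mono : ∀ k {i j} → i ℕ.≤ j → grid k i ≤ grid k j
  grid-mono k {i} {j} h = toℚᵘ-cancel-≤
    (ℚᵘ.≤-respʳ-≃ (ℚᵘ.≃-sym (grid-toℚᵘ k j)) (ℚᵘ.≤-respˡ-≃ (ℚᵘ.≃-sym (grid-toℚᵘ k i))
      (ℚᵘ.*≤* (ℤ.*-monoʳ-≤-nonNeg (+ suc k) (ℤ.+≤+ h)))))

  unit-anti : ∀ {k l} → k ℕ.≤ l → unit l ≤ unit k
  unit-anti {k} {l} h = toℚᵘ-cancel-≤
    (ℚᵘ.≤-respʳ-≃ (ℚᵘ.≃-sym (grid-toℚᵘ k 1)) (ℚᵘ.≤-respˡ-≃ (ℚᵘ.≃-sym (grid-toℚᵘ l 1))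
      (ℚᵘ.*≤* (ℤ.*-monoˡ-≤-nonNeg (+ 1) (ℤ.+≤+ (ℕ.s≤s h))))))

  archimedean : ∀ ε → 0ℚ < ε → unit (ℕ.pred (↧ₙ ε)) ≤ ε
  archimedean ε@(mkℚ (+ suc n) d-1 _) _ = toℚᵘ-cancel-≤
    (ℚᵘ.≤-respˡ-≃ (ℚᵘ.≃-sym (grid-toℚᵘ d-1 1))
      (ℚᵘ.*≤* (ℤ.*-monoʳ-≤-nonNeg (+ suc d-1) (ℤ.+≤+ (ℕ.s≤s (ℕ.z≤n {n}))))))
  archimedean (mkℚ (+ zero) _ _) h with () ← positive h
  archimedean (mkℚ ℤ.-[1+ _ ] _ _) h with () ← positive h

  eventually-unit≤ : ∀ ε → 0ℚ < ε → Eventually (λ k → unit k ≤ ε)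
  eventually-unit≤ ε h = ℕ.pred (↧ₙ ε) , λ k l → ≤-trans (unit-anti l) (archimedean ε h)

  rootBound : ℚ → ℕ → ℕ
  rootBound q k = suc (suc k ℕ.* suc ℤ.∣ ↥ q ∣)

  -- The greatest j ≤ b with (j / (k + 1))² ≤ q, or 0 if there is none.
  searchRoot : ℚ → ℕ → ℕ → ℕ
  searchRoot q k zero    = 0
  searchRoot q k (suc b) with grid k (suc b) * grid k (suc b) ≤? q
  ... | yes _ = suc b
  ... | no  _ = searchRoot q k b

  approxRoot : ℚ → ℕ → ℚ
  approxRoot q k = grid k (searchRoot q k (rootBound q k))

  0≤grid : ∀ k j → 0ℚ ≤ grid k j
  0≤grid k j = ≤-trans (≤-reflexive (sym (grid-zero k))) (grid-mono k ℕ.z≤n)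

  0≤approxRoot : ∀ q k → 0ℚ ≤ approxRoot q k
  0≤approxRoot q k = 0≤grid k (searchRoot q k (rootBound q k))

  searchRoot-lower : ∀ q k b → grid k (searchRoot q k b) ≡ 0ℚ ⊎
    grid k (searchRoot q k b) * grid k (searchRoot q k b) ≤ q
  searchRoot-lower q k zero = inj₁ (grid-zero k)
  searchRoot-lower q k (suc b) with grid k (suc b) * grid k (suc b) ≤? q
  ... | yes h = inj₂ h
  ... | no  _ = searchRoot-lower q k b

  searchRoot-upper : ∀ q k b → q < grid k (suc b) * grid k (suc b) →
    q < grid k (suc (searchRoot q k b)) * grid k (suc (searchRoot q k b))
  searchRoot-upper q k zero h = h
  searchRoot-upper q k (suc b) h with grid k (suc b) * grid k (suc b) ≤? q
  ... | yes _ = h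
  ... | no  n = searchRoot-upper q k b (≰⇒> n)

  q<bound : ∀ q k → q < grid k (suc k ℕ.* suc ℤ.∣ ↥ q ∣)
  q<bound q@(mkℚ n d-1 _) k = toℚᵘ-cancel-< (ℚᵘ.<-respʳ-≃ (ℚᵘ.≃-sym (grid-toℚᵘ k B)) (ℚᵘ.*<* lt))
    where
    B = suc k ℕ.* suc ℤ.∣ n ∣
    n<suc : ∀ n → n ℤ.< + suc ℤ.∣ n ∣
    n<suc (+ n) = ℤ.+<+ ℕ.≤-refl
    n<suc ℤ.-[1+ n ] = ℤ.-<+
    lt : n ℤ.* + suc k ℤ.< + B ℤ.* + suc d-1
    lt = ℤ.<-≤-trans (ℤ.*-monoʳ-<-pos (+ suc k) (n<suc n))
      (ℤ.≤-trans (ℤ.≤-reflexive (cong +_ (ℕ.*-comm (suc ℤ.∣ n ∣) (suc k))))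
        (ℤ.+≤+ (ℕ.m≤m*n B (suc d-1))))

  1≤bound : ∀ k b → 1ℚ ≤ grid k (suc k ℕ.* suc b)
  1≤bound k b = toℚᵘ-cancel-≤ (ℚᵘ.≤-respʳ-≃ (ℚᵘ.≃-sym (grid-toℚᵘ k (suc k ℕ.* suc b)))
    (ℚᵘ.*≤* (ℤ.≤-trans (ℤ.≤-reflexive (ℤ.*-identityˡ (+ suc k)))
      (ℤ.≤-trans (ℤ.+≤+ (ℕ.m≤m*n (suc k) (suc b)))
                 (ℤ.≤-reflexive (sym (ℤ.*-identityʳ _)))))))

  bound² : ∀ q k → q < grid k (suc (rootBound q k)) * grid k (suc (rootBound q k))
  bound² q k = begin-strict
    q          <⟨ q<bound q k ⟩
    g          ≡⟨ sym (*-identityʳ g) ⟩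
    g * 1ℚ     ≤⟨ *-mono-≤ (0≤grid k B) (0≤grid k B′) le (≤-trans (1≤bound k _) le) ⟩
    g′ * g′    ∎
    where
    B = suc k ℕ.* suc ℤ.∣ ↥ q ∣
    B′ = suc (rootBound q k)
    g = grid k B
    g′ = grid k B′
    le : g ≤ g′
    le = grid-mono k (ℕ.m≤n+m B 2)

  approxRoot-lower : ∀ q k → approxRoot q k ≡ 0ℚ ⊎ approxRoot q k * approxRoot q k ≤ q
  approxRoot-lower q k = searchRoot-lower q k (rootBound q k)

  approxRoot-upper : ∀ q k → q < (approxRoot q k + unit k) * (approxRoot q k + unit k)
  approxRoot-upper q k = subst (λ g → q < g * g) (grid-suc k _)
    (searchRoot-upper q k (rootBound q k) (bound² q k))

  square-+ : ∀ {a b} → 0ℚ ≤ a → 0ℚ ≤ b → a * a + b * b ≤ (a + b) * (a + b)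
  square-+ {a} {b} 0≤a 0≤b = begin
    a * a + b * b                      ≡⟨ sym (+-identityʳ _) ⟩
    (a * a + b * b) + 0ℚ               ≤⟨ +-monoʳ-≤ (a * a + b * b) 0≤2ab ⟩
    (a * a + b * b) + (a * b + a * b)  ≡⟨ solve 2 (λ a b → (a :* a :+ b :* b) :+ (a :* b :+ a :* b)
                                            := (a :+ b) :* (a :+ b)) refl a b ⟩
    (a + b) * (a + b)                  ∎
    where
    0≤ab : 0ℚ ≤ a * b
    0≤ab = nonNegative⁻¹ (a * b) {{nonNeg*nonNeg⇒nonNeg a {{nonNegative 0≤a}} b {{nonNegative 0≤b}}}}
    0≤2ab : 0ℚ ≤ a * b + a * b
    0≤2ab = +-mono-≤ 0≤ab 0≤ab

  approxRoot-continuous : ∀ {p q m n δ} → 0ℚ ≤ δ → unit n ≤ δ → ∣ p - q ∣ ≤ δ * δ →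
    approxRoot p m ≤ approxRoot q n + (δ + δ)
  approxRoot-continuous {p} {q} {m} {n} {δ} 0≤δ u≤δ h with approxRoot p m ≤? approxRoot q n + (δ + δ)
  ... | yes le = le
  ... | no nle = contradiction absurd (<-irrefl refl)
    where
    s = approxRoot p m
    t = approxRoot q n
    u = unit n
    0≤t = 0≤approxRoot q n
    0≤u : 0ℚ ≤ u
    0≤u = 0≤grid n 1
    gap : t + (δ + δ) < s
    gap = ≰⇒> nle
    0<s : 0ℚ < s
    0<s = ≤-<-trans (+-mono-≤ 0≤t (+-mono-≤ 0≤δ 0≤δ)) gap
    lower : s * s ≤ p
    lower with approxRoot-lower p m
    ... | inj₁ e = contradiction 0<s (<-irrefl (sym e))
    ... | inj₂ l = l
    le : (t + u) + δ ≤ s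
    le = begin
      (t + u) + δ    ≤⟨ +-monoˡ-≤ δ (+-monoʳ-≤ t u≤δ) ⟩
      (t + δ) + δ    ≡⟨ +-assoc t δ δ ⟩
      t + (δ + δ)    ≤⟨ <⇒≤ gap ⟩
      s              ∎
    0≤t+u = +-mono-≤ 0≤t 0≤u
    absurd : p < p
    absurd = begin-strict
      p                                ≤⟨ ∣p-q∣≤r⇒p≤q+r h ⟩
      q + δ * δ                        <⟨ +-monoˡ-< (δ * δ) (approxRoot-upper q n) ⟩
      (t + u) * (t + u) + δ * δ        ≤⟨ square-+ 0≤t+u 0≤δ ⟩
      ((t + u) + δ) * ((t + u) + δ)    ≤⟨ *-mono-≤ (+-mono-≤ 0≤t+u 0≤δ) (<⇒≤ 0<s) le le ⟩
      s * s                            ≤⟨ lower ⟩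
      p                                ∎

IsCauchy : (ℕ → ℚ) → Set
IsCauchy x = ∀ ε → 0ℚ ℚ.< ε →
  Σ[ N ∈ ℕ ] (∀ m n → N ℕ.≤ m → N ℕ.≤ n → ℚ.∣ x m ℚ.- x n ∣ ℚ.≤ ε)

-- Real numbers as Cauchy sequences of rationals, identified by _≃_ below.
record ℝ : Set where
  constructor mkℝ
  field
    seq    : ℕ → ℚ
    cauchy : IsCauchy seq

open ℝ

module RealLemmas where

  open import Data.Rational
  open import Data.Rational.Properties
  open import Data.Rational.Solver using (module +-*-Solver)
  open +-*-Solver using (solve; _:=_; _:+_; _:*_; _:-_; :-_; con)
  open RationalLemmas
  open ≤-Reasoning

  +-cauchy : ∀ {x y} → IsCauchy x → IsCauchy y → IsCauchy (λ n → x n + y n)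
  +-cauchy {x} {y} cx cy ε 0<ε =
    let M , f = cx (½ * ε) (0<half 0<ε)
        N , g = cy (½ * ε) (0<half 0<ε)
    in M ℕ.⊔ N , λ m n hm hn → begin
    ∣ (x m + y m) - (x n + y n) ∣
      ≡⟨ cong ∣_∣ (solve 4 (λ a b c d → (a :+ b) :- (c :+ d) := (a :- c) :+ (b :- d))
                    refl (x m) (y m) (x n) (y n)) ⟩
    ∣ (x m - x n) + (y m - y n) ∣    ≤⟨ ∣p+q∣≤∣p∣+∣q∣ (x m - x n) (y m - y n) ⟩
    ∣ x m - x n ∣ + ∣ y m - y n ∣
      ≤⟨ +-mono-≤ (f m n (ℕ.≤-trans (ℕ.m≤m⊔n M N) hm) (ℕ.≤-trans (ℕ.m≤m⊔n M N) hn))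
                  (g m n (ℕ.≤-trans (ℕ.m≤n⊔m M N) hm) (ℕ.≤-trans (ℕ.m≤n⊔m M N) hn)) ⟩
    ½ * ε + ½ * ε                    ≡⟨ half+half ε ⟩
    ε                                ∎

  neg-cauchy : ∀ {x} → IsCauchy x → IsCauchy (λ n → - x n)
  neg-cauchy {x} cx ε 0<ε = let N , f = cx ε 0<ε in N , λ m n hm hn → ≤-trans
    (≤-reflexive (trans (sym (∣-p∣≡∣p∣ (- x m - (- x n))))
      (cong ∣_∣ (solve 2 (λ a b → :- (:- a :- (:- b)) := a :- b) refl (x m) (x n)))))
    (f m n hm hn)

  bounded : ∀ {x} → IsCauchy x → Σ[ b ∈ ℚ ] (0ℚ < b × Eventually (λ n → ∣ x n ∣ ≤ b))
  bounded {x} cx = let N , f = cx 1ℚ (positive⁻¹ 1ℚ) in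
    ∣ x N ∣ + 1ℚ , +-mono-≤-< (0≤∣p∣ (x N)) (positive⁻¹ 1ℚ) , N , λ n h →
    ≤-trans (∣p∣≤∣q∣+∣p-q∣ (x n) (x N)) (+-monoʳ-≤ ∣ x N ∣ (f n N h ℕ.≤-refl))

  *-cauchy : ∀ {x y} → IsCauchy x → IsCauchy y → IsCauchy (λ n → x n * y n)
  *-cauchy {x} {y} cx cy ε 0<ε =
    let a , 0<a , K , bx = bounded {x} cx
        b , 0<b , L , by = bounded {y} cy
        δ , 0<δ , eq = scale (a + b) (+-mono-< 0<a 0<b) ε 0<ε
        M , f = cx δ 0<δ
        N , g = cy δ 0<δ
        toK = λ {n} (h : (K ℕ.⊔ L) ℕ.⊔ (M ℕ.⊔ N) ℕ.≤ n) → ℕ.≤-trans (ℕ.m≤m⊔n K L) (ℕ.≤-trans (ℕ.m≤m⊔n (K ℕ.⊔ L) (M ℕ.⊔ N)) h)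
        toL = λ {n} (h : (K ℕ.⊔ L) ℕ.⊔ (M ℕ.⊔ N) ℕ.≤ n) → ℕ.≤-trans (ℕ.m≤n⊔m K L) (ℕ.≤-trans (ℕ.m≤m⊔n (K ℕ.⊔ L) (M ℕ.⊔ N)) h)
        toM = λ {n} (h : (K ℕ.⊔ L) ℕ.⊔ (M ℕ.⊔ N) ℕ.≤ n) → ℕ.≤-trans (ℕ.m≤m⊔n M N) (ℕ.≤-trans (ℕ.m≤n⊔m (K ℕ.⊔ L) (M ℕ.⊔ N)) h)
        toN = λ {n} (h : (K ℕ.⊔ L) ℕ.⊔ (M ℕ.⊔ N) ℕ.≤ n) → ℕ.≤-trans (ℕ.m≤n⊔m M N) (ℕ.≤-trans (ℕ.m≤n⊔m (K ℕ.⊔ L) (M ℕ.⊔ N)) h)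
    in (K ℕ.⊔ L) ℕ.⊔ (M ℕ.⊔ N) , λ m n hm hn → begin
    ∣ x m * y m - x n * y n ∣
      ≡⟨ cong ∣_∣ (solve 4 (λ a b c d → a :* b :- c :* d := a :* (b :- d) :+ (a :- c) :* d)
                    refl (x m) (y m) (x n) (y n)) ⟩
    ∣ x m * (y m - y n) + (x m - x n) * y n ∣
      ≤⟨ ∣p+q∣≤∣p∣+∣q∣ (x m * (y m - y n)) ((x m - x n) * y n) ⟩
    ∣ x m * (y m - y n) ∣ + ∣ (x m - x n) * y n ∣
      ≡⟨ cong₂ _+_ (∣p*q∣≡∣p∣*∣q∣ (x m) (y m - y n)) (∣p*q∣≡∣p∣*∣q∣ (x m - x n) (y n)) ⟩
    ∣ x m ∣ * ∣ y m - y n ∣ + ∣ x m - x n ∣ * ∣ y n ∣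
      ≤⟨ +-mono-≤
           (*-mono-≤ (0≤∣p∣ (x m)) (<⇒≤ 0<δ) (bx m (toK hm)) (g m n (toN hm) (toN hn)))
           (*-mono-≤ (0≤∣p∣ (x m - x n)) (<⇒≤ 0<b) (f m n (toM hm) (toM hn)) (by n (toL hn))) ⟩
    a * δ + δ * b
      ≡⟨ solve 3 (λ a b d → a :* d :+ d :* b := (a :+ b) :* d) refl a b δ ⟩
    (a + b) * δ    ≡⟨ eq ⟩
    ε              ∎

  const-cauchy : ∀ q → IsCauchy (λ _ → q)
  const-cauchy q ε 0<ε = 0 , λ _ _ _ _ →
    ≤-trans (≤-reflexive (cong ∣_∣ (+-inverseʳ q))) (<⇒≤ 0<ε)

  √-cauchy : ∀ {x} → IsCauchy x → IsCauchy (λ n → approxRoot (x n) n)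
  √-cauchy {x} cx ε 0<ε = M ℕ.⊔ N , λ m n hm hn → close (le m n hm hn) (le n m hn hm)
    where
    δ = ½ * ε
    0<δ : 0ℚ < δ
    0<δ = 0<half 0<ε
    near = cx (δ * δ) (positive⁻¹ (δ * δ) {{pos*pos⇒pos δ {{positive 0<δ}} δ {{positive 0<δ}}}})
    small = eventually-unit≤ δ 0<δ
    M = proj₁ near
    N = proj₁ small
    le : ∀ m n → M ℕ.⊔ N ℕ.≤ m → M ℕ.⊔ N ℕ.≤ n → approxRoot (x m) m ≤ approxRoot (x n) n + ε
    le m n hm hn = ≤-trans
      (approxRoot-continuous (<⇒≤ 0<δ)
        (proj₂ small n (ℕ.≤-trans (ℕ.m≤n⊔m M N) hn))
        (proj₂ near m n (ℕ.≤-trans (ℕ.m≤m⊔n M N) hm) (ℕ.≤-trans (ℕ.m≤m⊔n M N) hn)))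
      (≤-reflexive (cong (λ t → approxRoot (x n) n + t) (half+half ε)))

  module _ {x : ℕ → ℚ} (cx : IsCauchy x)
           (0≤x : ∀ ε → 0ℚ < ε → Eventually (λ n → 0ℚ ≤ x n + ε)) where

    private
      s : ℕ → ℚ
      s n = approxRoot (x n) n

    √-square : ∀ ε → 0ℚ < ε → Eventually (λ n → ∣ s n * s n - x n ∣ ≤ ε)
    √-square ε 0<ε = (K ℕ.⊔ L) ℕ.⊔ M , λ n h → close
        (lower n (ℕ.≤-trans (ℕ.≤-trans (ℕ.m≤n⊔m K L) (ℕ.m≤m⊔n (K ℕ.⊔ L) M)) h))
        (upper n (ℕ.≤-trans (ℕ.≤-trans (ℕ.m≤m⊔n K L) (ℕ.m≤m⊔n (K ℕ.⊔ L) M)) h)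
                 (ℕ.≤-trans (ℕ.m≤n⊔m (K ℕ.⊔ L) M) h))
      where
      bound = bounded {s} (√-cauchy {x} cx)
      b = proj₁ bound
      0<b = proj₁ (proj₂ bound)
      K = proj₁ (proj₂ (proj₂ bound))
      bs = proj₂ (proj₂ (proj₂ bound))
      tolerance = scale (b + (b + 1ℚ)) (+-mono-< 0<b (+-mono-< 0<b (positive⁻¹ 1ℚ))) ε 0<ε
      δ = proj₁ tolerance
      0<δ = proj₁ (proj₂ tolerance)
      eq = proj₂ (proj₂ tolerance)
      L = proj₁ (0≤x ε 0<ε)
      nonneg = proj₂ (0≤x ε 0<ε)
      M = proj₁ (eventually-unit≤ δ 0<δ)
      small = proj₂ (eventually-unit≤ δ 0<δ)
      lower : ∀ n → L ℕ.≤ n → s n * s n ≤ x n + ε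
      lower n h with approxRoot-lower (x n) n
      ... | inj₁ e = ≤-trans (≤-reflexive (trans (cong (_* s n) e) (*-zeroˡ (s n)))) (nonneg n h)
      ... | inj₂ l = ≤-trans l (≤-trans (≤-reflexive (sym (+-identityʳ _))) (+-monoʳ-≤ (x n) (<⇒≤ 0<ε)))
      upper : ∀ n → K ℕ.≤ n → M ℕ.≤ n → x n ≤ s n * s n + ε
      upper n hK hM = begin
        x n                            <⟨ approxRoot-upper (x n) n ⟩
        (s n + u) * (s n + u)              ≡⟨ solve 2 (λ s u → (s :+ u) :* (s :+ u)
                                                := s :* s :+ (s :+ (s :+ u)) :* u) refl (s n) u ⟩
        s n * s n + (s n + (s n + u)) * u  ≤⟨ +-monoʳ-≤ (s n * s n) (*-mono-≤
                                                (+-mono-≤ 0≤s (+-mono-≤ 0≤s (0≤grid n 1)))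
                                                (<⇒≤ 0<δ)
                                                (+-mono-≤ s≤b (+-mono-≤ s≤b u≤1)) (small n hM)) ⟩
        s n * s n + (b + (b + 1ℚ)) * δ     ≡⟨ cong (λ t → s n * s n + t) eq ⟩
        s n * s n + ε                      ∎
        where
        u = unit n
        0≤s = 0≤approxRoot (x n) n
        s≤b : s n ≤ b
        s≤b = ≤-trans (p≤∣p∣ (s n)) (bs n hK)
        u≤1 : u ≤ 1ℚ
        u≤1 = ≤-trans (unit-anti ℕ.z≤n) (archimedean 1ℚ (positive⁻¹ 1ℚ))

infix 4 _≃_ _≤_ _<_

record _≃_ (x y : ℝ) : Set where
  constructor mk≃
  field
    close : ∀ ε → 0ℚ ℚ.< ε → Eventually (λ n → ℚ.∣ seq x n ℚ.- seq y n ∣ ℚ.≤ ε)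

record _≤_ (x y : ℝ) : Set where
  constructor mk≤
  field
    below : ∀ ε → 0ℚ ℚ.< ε → Eventually (λ n → seq x n ℚ.≤ seq y n ℚ.+ ε)

record _<_ (x y : ℝ) : Set where
  constructor mk<
  field
    gap       : ℚ
    gap-pos   : 0ℚ ℚ.< gap
    separated : Eventually (λ n → seq x n ℚ.+ gap ℚ.≤ seq y n)

infixl 6 _+_ _-_
infixl 7 _*_
infix 8 -_ √_

-- The operations are opaque because arithmetic on ℚ normalises to large terms.
opaque

  _+_ _*_ : ℝ → ℝ → ℝ
  x + y = mkℝ (λ n → seq x n ℚ.+ seq y n) (RealLemmas.+-cauchy {seq x} {seq y} (cauchy x) (cauchy y))
  x * y = mkℝ (λ n → seq x n ℚ.* seq y n) (RealLemmas.*-cauchy {seq x} {seq y} (cauchy x) (cauchy y))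

  -_ : ℝ → ℝ
  -_ x = mkℝ (λ n → ℚ.- seq x n) (RealLemmas.neg-cauchy {seq x} (cauchy x))

  fromℚ : ℚ → ℝ
  fromℚ q = mkℝ (λ _ → q) (RealLemmas.const-cauchy q)

  -- By convention the root of a negative number is 0.
  √_ : ℝ → ℝ
  √ x = mkℝ (λ n → RationalLemmas.approxRoot (seq x n) n) (RealLemmas.√-cauchy {seq x} (cauchy x))

  seq-+ : ∀ x y n → seq (x + y) n ≡ seq x n ℚ.+ seq y n
  seq-+ x y n = refl

  seq-* : ∀ x y n → seq (x * y) n ≡ seq x n ℚ.* seq y n
  seq-* x y n = refl

  seq-neg : ∀ x n → seq (- x) n ≡ ℚ.- seq x n
  seq-neg x n = refl

  seq-fromℚ : ∀ q n → seq (fromℚ q) n ≡ q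
  seq-fromℚ q n = refl

  seq-√ : ∀ x n → seq (√ x) n ≡ RationalLemmas.approxRoot (seq x n) n
  seq-√ x n = refl

_-_ : ℝ → ℝ → ℝ
x - y = x + (- y)

fromℕ : ℕ → ℝ
fromℕ n = fromℚ (+ n ℚ./ 1)

0ℝ 1ℝ : ℝ
0ℝ = fromℚ 0ℚ
1ℝ = fromℚ 1ℚ

opaque
  unfolding √_

  √-nonneg : ∀ x → 0ℝ ≤ √ x
  √-nonneg x = mk≤ λ ε 0<ε → 0 , λ n _ →
    ℚ.+-mono-≤ (RationalLemmas.0≤approxRoot (seq x n) n) (ℚ.<⇒≤ 0<ε)

  √-square : ∀ x → 0ℝ ≤ x → √ x * √ x ≃ x
  √-square x (mk≤ 0≤x) = mk≃ (RealLemmas.√-square {seq x} (cauchy x) 0≤x)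

infix 4 _⟶_ _⟶∞

_⟶_ : (ℕ → ℝ) → ℝ → Set
x ⟶ l = ∀ ε → 0ℚ ℚ.< ε → Eventually (λ n → l - fromℚ ε < x n × x n < l + fromℚ ε)

_⟶∞ : (ℕ → ℝ) → Set
x ⟶∞ = ∀ K → Eventually (λ n → fromℕ K < x n)

+-0-rawMonoid : RawMonoid 0ℓ 0ℓ
+-0-rawMonoid = record { Carrier = ℝ ; _≈_ = _≃_ ; _∙_ = _+_ ; ε = 0ℝ }

open import Algebra.Definitions.RawMonoid +-0-rawMonoid using (sum)

record FiniteProbabilitySpace : Set where
  field
    size          : ℕ
    weight        : Fin size → ℝ
    weight-nonneg : ∀ ω → 0ℝ ≤ weight ω
    weight-total  : sum weight ≃ 1ℝ

  Ω : Set
  Ω = Fin size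

  Pr : {P : Ω → Set} → Decidable P → ℝ
  Pr P? = sum (λ ω → if does (P? ω) then weight ω else 0ℝ)

record SimpleGraph (n : ℕ) : Set where
  field
    adjacent : Fin n → Fin n → Bool
    symmetric : ∀ i j → adjacent i j ≡ adjacent j i
    loopless  : ∀ i → adjacent i i ≡ false

  neighbours : Fin n → Subset n
  neighbours i = tabulate (adjacent i)

open SimpleGraph

MaxDegree≤ : ∀ {m} → SimpleGraph m → ℕ → Set
MaxDegree≤ D d = ∀ i → Subset.∣ neighbours D i ∣ ℕ.≤ d

module _ (μ : FiniteProbabilitySpace) {m : ℕ}
         (X : Fin m → FiniteProbabilitySpace.Ω μ → Bool) where

  open FiniteProbabilitySpace μ

  -- The variables that are neither Xᵢ nor adjacent to it take the values c.
  Elsewhere : SimpleGraph m → Fin m → (Fin m → Bool) → Ω → Set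
  Elsewhere D i c ω = ∀ j → j ≢ i → adjacent D i j ≡ false → X j ω ≡ c j

  elsewhere? : ∀ D i c → Decidable (Elsewhere D i c)
  elsewhere? D i c ω = all? λ j →
    ¬? (j Fin.≟ i) →-dec (adjacent D i j Bool.≟ false) →-dec (X j ω Bool.≟ c j)

  IsDependencyGraph : SimpleGraph m → Set
  IsDependencyGraph D = ∀ i b c →
    Pr (λ ω → (X i ω Bool.≟ b) ×-dec elsewhere? D i c ω) ≃
    Pr (λ ω → X i ω Bool.≟ b) * Pr (elsewhere? D i c)

  LocallyDependent : ℕ → Set
  LocallyDependent d = Σ[ D ∈ SimpleGraph m ] (IsDependencyGraph D × MaxDegree≤ D d)

pairs : ∀ n → List (Fin n × Fin n)
pairs n = filter (λ (i , j) → i Fin.<? j) (cartesianProduct (allFin n) (allFin n))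

-- A distribution on graphs, as the law of a graph-valued random variable.
record RandomGraph (n : ℕ) : Set where
  field
    space : FiniteProbabilitySpace
    graph : FiniteProbabilitySpace.Ω space → SimpleGraph n

  open FiniteProbabilitySpace space public

  edge : Fin (length (pairs n)) → Ω → Bool
  edge k ω = let (i , j) = lookup (pairs n) k in adjacent (graph ω) i j

record IsDependentRandomGraph {n} (p : ℝ) (d : ℕ) (G : RandomGraph n) : Set where
  open RandomGraph G
  field
    edge-probability : ∀ k → Pr (λ ω → edge k ω Bool.≟ true) ≃ p
    edge-dependence  : LocallyDependent space edge d

-- Counting adjacent pairs in A × B counts the edges inside A ∩ B twice.
e : ∀ {n} → SimpleGraph n → Subset n → Subset n → ℕ
e {n} G A B = length (filter
  (λ (a , b) → (a ∈? A) ×-dec (b ∈? B) ×-dec (adjacent G a b Bool.≟ true))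
  (cartesianProduct (allFin n) (allFin n)))

-- The order on ℝ is undecidable, so an event E need not have a probability that
-- can be computed; it holds almost surely when it contains decidable events
-- whose probability tends to 1. Classically these can be taken to be E itself.
AlmostSurely : (∀ n → RandomGraph n) → (∀ n → .{{NonZero n}} → SimpleGraph n → Set) → Set
AlmostSurely G E =
  Σ[ S ∈ (∀ n → Subset (RandomGraph.size (G n))) ]
    (∀ n → .{{_ : NonZero n}} → ∀ ω → ω ∈ S n → E n (RandomGraph.graph (G n) ω)) ×
    ((λ n → RandomGraph.Pr (G n) (_∈? S n)) ⟶ 1ℝ)

{-# OPTIONS --safe #-}
module Submission where

-- Fix B = {i ≤ d}. For each vertex v > d the d + 1 pairs between v and B share
-- a single coin of bias p, and every other pair has a coin of its own, so a pair
-- depends only on the at most d others with the same coin. Let A be the set of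
-- vertices v > d whose coin is heads. All pairs between A and B are edges, hence
-- e(A,B) − p|A||B| = (1 − p)|A|(d + 1), and the claimed bound reduces to
-- |A| ≥ (1 − o(1))(n − d)p. Now |A| is binomial with mean (n − d − 1)p, which
-- tends to infinity since n − d > n/100, so Chebyshev's inequality applies.
--
-- Since p is a real number and the order on ℝ is undecidable, the almost sure
-- event compares |A| with a natural number s approximating the mean; it asks for
-- |A| > r(s + 3)/(r + 1) with r = ⌊∛s⌋, which is decidable.

open import Defs
open import Algebra.Bundles using (CommutativeRing)
import Algebra.Solver.Ring
open import Algebra.Solver.Ring.AlmostCommutativeRing using (fromCommutativeRing; _-Raw-AlmostCommutative⟶_)
open import Algebra.Definitions.RawMonoid +-0-rawMonoid using (sum)
open import Data.Bool using (Bool; true; false; if_then_else_; not; _∧_)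
import Data.Bool as Bool
open import Data.Fin using (Fin; zero; suc; _↑ˡ_; _↑ʳ_; splitAt; toℕ; fromℕ<; combine; punchOut)
import Data.Fin as Fin
import Data.Fin.Properties as Fin
open import Data.Fin.Subset using (Subset; ∣_∣; _∩_; ∁; _∈_)
import Data.Fin.Subset as Subset
open import Data.Fin.Subset.Properties using (_∈?_; x∈p⇒∣p-x∣<∣p∣; x∈p∧x≢y⇒x∈p-y; p⊆q⇒∣p∣≤∣q∣; ∣∁p∣≡n∸∣p∣; x∈p∩q⁻; x∈∁p⇒x∉p)
open import Data.Integer using (+_)
import Data.Integer as ℤ
import Data.Integer.Properties as ℤ
open import Data.List as List using (List; []; _∷_; length; filter; cartesianProduct; allFin)
import Data.List.Properties as List
open import Data.List.Membership.Propositional.Properties using (∈-lookup)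
import Data.List.Relation.Unary.All as All
open import Data.List.Relation.Unary.All.Properties using (all-filter)
open import Data.List.Relation.Unary.AllPairs using ([]; _∷_)
open import Data.List.Relation.Unary.Unique.Propositional using (Unique)
import Data.List.Relation.Unary.Unique.Propositional.Properties as Unique
open import Data.Maybe using (Maybe; nothing; just)
open import Data.Nat as ℕ using (ℕ; zero; suc; NonZero)
import Data.Nat.Properties as ℕ
open import Data.Nat.Solver using () renaming (module +-*-Solver to ℕ-Solver)
open import Data.Product using (Σ-syntax; _×_; _,_; proj₁; proj₂)
open import Data.Rational as ℚ using (ℚ; 0ℚ; 1ℚ; ½)
import Data.Rational.Properties as ℚ
open import Data.Rational.Solver using () renaming (module +-*-Solver to ℚ-Solver)
import Data.Rational.Unnormalised as ℚᵘ
import Data.Rational.Unnormalised.Properties as ℚᵘ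
open import Data.Sum using (inj₁; inj₂; [_,_]′)
open import Data.Vec using (Vec; []; _∷_; take; lookup; _[_]≔_; tabulate; here; there)
open import Data.Vec.Properties using (lookup∘tabulate; lookup∘update′; lookup⇒[]=; []=⇒lookup)
open import Function using (case_of_; _∘_; mk⇔)
open import Level using (0ℓ)
open import Relation.Binary.Bundles using (Setoid)
open import Relation.Binary.Definitions using (_Respects₂_; tri<; tri≈; tri>)
open import Relation.Binary.PropositionalEquality
  using (_≡_; _≢_; refl; sym; trans; cong; cong₂; subst; subst₂; ≢-sym)
open import Relation.Binary.Structures using (IsEquivalence; IsPreorder)
import Relation.Binary.Reasoning.Base.Triple
open import Relation.Nullary using (¬_; Dec; yes; no; does; ¬?; contradiction)
open import Relation.Nullary.Decidable using (_×-dec_; _→-dec_; does-⇔; dec-true; dec-false)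
open import Relation.Unary using (Decidable)

-- Arithmetic of the parameters

-- The choice of `r` balances two errors. A target lower than the mean by the factor `r / (r + 1)`
-- loses a relative error of about `1 / r` in |A|. It also leaves a deviation of about `s / r`
-- against a variance of at most about `s`, so Chebyshev's inequality bounds the failure probability
-- by about `r² / s`. For `r` near the cube root of `s` both errors are of order `1 / r`, and they
-- vanish however slowly `s` grows.
--
-- The pairs that share a coin form a clique of the dependency graph, and a clique in a graph of
-- maximum degree d has at most d + 1 vertices; this fixes the size of B. The factor `1 - d / n` in
-- the bound is the price of removing B from the candidates for A:
-- `(1 - d / n) * n * p = (n - d) * p` is, up to a single vertex, the mean of |A|. Squaring both
-- sides and cancelling `(1 - p)² |A| (d + 1)²` leaves the comparison of |A| with that mean.

cube : ℕ → ℕ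
cube r = r ℕ.* r ℕ.* r

cbrt : ℕ → ℕ
cbrt zero = 0
cbrt (suc s) with cube (suc (cbrt s)) ℕ.≤? suc s
... | yes _ = suc (cbrt s)
... | no  _ = cbrt s

cube-mono-≤ : ∀ {a b} → a ℕ.≤ b → cube a ℕ.≤ cube b
cube-mono-≤ h = ℕ.*-mono-≤ (ℕ.*-mono-≤ h h) h

cube-cbrt≤ : ∀ s → cube (cbrt s) ℕ.≤ s
cube-cbrt≤ zero = ℕ.z≤n
cube-cbrt≤ (suc s) with cube (suc (cbrt s)) ℕ.≤? suc s
... | yes h = h
... | no  _ = ℕ.m≤n⇒m≤1+n (cube-cbrt≤ s)

-- When the root is incremented, the induction hypothesis gives `suc s ≤ cube (suc (cbrt s))`, and
-- the next cube is strictly larger; so raising the root by one per step is always enough.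
<cube-cbrt : ∀ s → s ℕ.< cube (suc (cbrt s))
<cube-cbrt zero = ℕ.s≤s ℕ.z≤n
<cube-cbrt (suc s) with cube (suc (cbrt s)) ℕ.≤? suc s
... | yes _ = ℕ.<-≤-trans (ℕ.s≤s (<cube-cbrt s)) (cube-< (suc (cbrt s)))
  where
  cube-< : ∀ a → cube a ℕ.< cube (suc a)
  cube-< a = ℕ.*-mono-< {a ℕ.* a} {suc a ℕ.* suc a} {a} {suc a} (ℕ.*-mono-< {a} {suc a} {a} {suc a} ℕ.≤-refl ℕ.≤-refl) ℕ.≤-refl
... | no ¬h = ℕ.≰⇒> ¬h

cube≤⇒≤cbrt : ∀ {r s} → cube r ℕ.≤ s → r ℕ.≤ cbrt s
cube≤⇒≤cbrt {r} {s} h = ℕ.≮⇒≥ λ lt →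
  ℕ.<-irrefl refl (ℕ.<-≤-trans (<cube-cbrt s) (ℕ.≤-trans (cube-mono-≤ lt) h))

-- W / (r + 1) is the deviation from the mean to which Chebyshev's inequality is applied.
variance≤deviation² : ∀ K r s → 1 ℕ.≤ K → 33 ℕ.* K ℕ.≤ r → cube r ℕ.≤ s →
  Σ[ W ∈ ℕ ] (W ℕ.+ (1 ℕ.+ 4 ℕ.* r) ≡ s × 0 ℕ.< W ×
    K ℕ.* (suc r ℕ.* suc r ℕ.* (s ℕ.+ 2)) ℕ.≤ W ℕ.* W)
variance≤deviation² K r s 1≤K 33K≤r r³≤s = W , ℕ.m∸n+n≡m D≤s , ℕ.<-≤-trans (ℕ.s≤s ℕ.z≤n) D≤W ,
  -- Replacing `suc r` by `2 * r` twice and `s + 2` by `2 * s` costs a factor 8, and `s ≤ 2 * W`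
  -- costs 4 more. The resulting factor `32 * K` is traded for one `r`, which completes
  -- `cube r ≤ s`.
  ℕ.*-cancelˡ-≤ 4 (begin
    4 ℕ.* (K ℕ.* (suc r ℕ.* suc r ℕ.* (s ℕ.+ 2)))
      ≤⟨ ℕ.*-monoʳ-≤ 4 (ℕ.*-monoʳ-≤ K (ℕ.*-mono-≤ (ℕ.*-mono-≤ 1+r≤2r 1+r≤2r) s+2≤2s)) ⟩
    4 ℕ.* (K ℕ.* (2 ℕ.* r ℕ.* (2 ℕ.* r) ℕ.* (2 ℕ.* s)))
      ≡⟨ solve 3 (λ K r s → 
           con 4 :* (K :* (con 2 :* r :* (con 2 :* r) :* (con 2 :* s))) := con 32 :* K :* (r :* r) :* s) refl K r s ⟩
    32 ℕ.* K ℕ.* (r ℕ.* r) ℕ.* s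
      ≤⟨ ℕ.*-monoˡ-≤ s (ℕ.*-monoˡ-≤ (r ℕ.* r) (ℕ.≤-trans (ℕ.*-monoˡ-≤ K (ℕ.m≤m+n 32 1)) 33K≤r)) ⟩
    r ℕ.* (r ℕ.* r) ℕ.* s
      ≤⟨ ℕ.*-monoˡ-≤ s (ℕ.≤-trans (ℕ.≤-reflexive (ℕ.*-comm r (r ℕ.* r))) r³≤s) ⟩
    s ℕ.* s              ≤⟨ ℕ.*-mono-≤ s≤2W s≤2W ⟩
    2 ℕ.* W ℕ.* (2 ℕ.* W)
      ≡⟨ solve 1 (λ W → con 2 :* W :* (con 2 :* W) := con 4 :* (W :* W)) refl W ⟩
    4 ℕ.* (W ℕ.* W)      ∎)
  where
  open ℕ.≤-Reasoning
  open ℕ-Solver using (solve; _:=_; _:+_; _:*_; con)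
  -- Chosen so that `suc r * s - r * (s + 3) - suc r = s - D`, the deviation available to a bad
  -- outcome after scaling by `suc r`.
  D = 1 ℕ.+ 4 ℕ.* r
  W = s ℕ.∸ D
  33≤r : 33 ℕ.≤ r
  33≤r = ℕ.≤-trans (ℕ.*-monoʳ-≤ 33 1≤K) 33K≤r
  1≤r : 1 ℕ.≤ r
  1≤r = ℕ.≤-trans (ℕ.m≤m+n 1 32) 33≤r
  10r≤s : 10 ℕ.* r ℕ.≤ s
  10r≤s = ℕ.≤-trans (ℕ.*-monoˡ-≤ r (ℕ.*-mono-≤ {10} {r} {1} {r} (ℕ.≤-trans (ℕ.m≤m+n 10 23) 33≤r) 1≤r)) r³≤s
  2D≤s : D ℕ.+ D ℕ.≤ s
  2D≤s = begin
    D ℕ.+ D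
      ≡⟨ solve 1 (λ r → let D = con 1 :+ con 4 :* r in D :+ D := con 2 :* con 1 :+ con 8 :* r) refl r ⟩
    2 ℕ.* 1 ℕ.+ 8 ℕ.* r        ≤⟨ ℕ.+-monoˡ-≤ (8 ℕ.* r) (ℕ.*-monoʳ-≤ 2 1≤r) ⟩
    2 ℕ.* r ℕ.+ 8 ℕ.* r        ≡⟨ sym (ℕ.*-distribʳ-+ r 2 8) ⟩
    10 ℕ.* r                   ≤⟨ 10r≤s ⟩
    s                          ∎
  D≤s : D ℕ.≤ s
  D≤s = ℕ.≤-trans (ℕ.m≤m+n D D) 2D≤s
  D≤W : D ℕ.≤ W
  D≤W = ℕ.m+n≤o⇒m≤o∸n D 2D≤s
  s≤2W : s ℕ.≤ 2 ℕ.* W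
  s≤2W = begin
    s                ≡⟨ sym (ℕ.m∸n+n≡m D≤s) ⟩
    W ℕ.+ D          ≤⟨ ℕ.+-monoʳ-≤ W D≤W ⟩
    W ℕ.+ W          ≡⟨ cong (W ℕ.+_) (sym (ℕ.+-identityʳ W)) ⟩
    2 ℕ.* W          ∎
  1+r≤2r : suc r ℕ.≤ 2 ℕ.* r
  1+r≤2r = begin
    1 ℕ.+ r          ≤⟨ ℕ.+-monoˡ-≤ r 1≤r ⟩
    r ℕ.+ r          ≡⟨ cong (r ℕ.+_) (sym (ℕ.+-identityʳ r)) ⟩
    2 ℕ.* r          ∎
  s+2≤2s : s ℕ.+ 2 ℕ.≤ 2 ℕ.* s
  s+2≤2s = begin
    s ℕ.+ 2          ≤⟨ ℕ.+-monoʳ-≤ s (ℕ.≤-trans (ℕ.*-mono-≤ {2} {10} {1} {r} (ℕ.m≤m+n 2 8) 1≤r) 10r≤s) ⟩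
    s ℕ.+ s          ≡⟨ cong (s ℕ.+_) (sym (ℕ.+-identityʳ s)) ⟩
    2 ℕ.* s          ∎

-- The separate summand `suc r` is an allowance: `s` may exceed the true mean by 1, which becomes
-- `suc r` after scaling.
bad⇒deviation : ∀ W r s a → W ℕ.+ (1 ℕ.+ 4 ℕ.* r) ≡ s → suc r ℕ.* a ℕ.≤ r ℕ.* (s ℕ.+ 3) →
  W ℕ.+ suc r ℕ.* a ℕ.+ suc r ℕ.≤ suc r ℕ.* s
bad⇒deviation W r _ a refl h = ℕ.≤-trans (ℕ.+-monoˡ-≤ (suc r) (ℕ.+-monoʳ-≤ W h)) (ℕ.≤-reflexive
  (solve 2 (λ W r → let s = W :+ (con 1 :+ con 4 :* r) in
    W :+ r :* (s :+ con 3) :+ (con 1 :+ r) := (con 1 :+ r) :* s) refl W r))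
  where open ℕ-Solver using (solve; _:=_; _:+_; _:*_; con)

-- This is `n - d > n / 100` for `m = n - d - 1`. It makes the number of candidates for A comparable
-- to n, so that its product with p inherits the divergence of np.
n≤100m+100 : ∀ {n m d} → 100 ℕ.* d ℕ.< 99 ℕ.* n → m ℕ.+ suc d ≡ n → n ℕ.≤ 100 ℕ.* m ℕ.+ 100
n≤100m+100 {n} {m} {d} 100d<99n m+1+d≡n = ℕ.+-cancelʳ-≤ (99 ℕ.* n) n (100 ℕ.* m ℕ.+ 100) (begin
  n ℕ.+ 99 ℕ.* n                          ≡⟨ cong (100 ℕ.*_) (sym m+1+d≡n) ⟩
  100 ℕ.* (m ℕ.+ suc d)
    ≡⟨ solve 2 (λ m d → con 100 :* (m :+ (con 1 :+ d)) := con 100 :* m :+ con 100 :+ con 100 :* d) refl m d ⟩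
  100 ℕ.* m ℕ.+ 100 ℕ.+ 100 ℕ.* d         ≤⟨ ℕ.+-monoʳ-≤ (100 ℕ.* m ℕ.+ 100) (ℕ.<⇒≤ 100d<99n) ⟩
  100 ℕ.* m ℕ.+ 100 ℕ.+ 99 ℕ.* n          ∎)
  where
  open ℕ.≤-Reasoning
  open ℕ-Solver using (solve; _:=_; _:+_; _:*_; con)

-- Finite sets

dec-true⁻¹ : ∀ {P : Set} (P? : Dec P) → does P? ≡ true → P
dec-true⁻¹ (yes p) _ = p

lookup-injective : ∀ {A : Set} {xs : List A} → Unique xs → ∀ i j →
  List.lookup xs i ≡ List.lookup xs j → i ≡ j
lookup-injective (x∉ ∷ u) zero    zero    e = refl
lookup-injective {xs = _ ∷ xs} (x∉ ∷ u) zero    (suc j) e = contradiction e (All.lookup x∉ (∈-lookup j))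
lookup-injective {xs = _ ∷ xs} (x∉ ∷ u) (suc i) zero    e = contradiction (sym e) (All.lookup x∉ (∈-lookup i))
lookup-injective (x∉ ∷ u) (suc i) (suc j) e = cong suc (lookup-injective u i j e)

-- Pigeonhole by induction on `p`: when the head belongs to `p`, punching its image out of `Fin k`
-- leaves an injection of the tail into a set with one element fewer.
injection⇒∣p∣≤k : ∀ {m k} (p : Subset m) (f : ∀ {x} → x ∈ p → Fin k) →
  (∀ {x y} (x∈ : x ∈ p) (y∈ : y ∈ p) → f x∈ ≡ f y∈ → x ≡ y) → ∣ p ∣ ℕ.≤ k
injection⇒∣p∣≤k [] f inj = ℕ.z≤n
injection⇒∣p∣≤k (false ∷ p) f inj =
  injection⇒∣p∣≤k p (f ∘ there) (λ x∈ y∈ e → Fin.suc-injective (inj (there x∈) (there y∈) e))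
injection⇒∣p∣≤k {k = zero}  (true ∷ p) f inj = case f here of λ ()
injection⇒∣p∣≤k {k = suc k} (true ∷ p) f inj = ℕ.s≤s (injection⇒∣p∣≤k p
  (λ x∈ → punchOut (f₀≢ x∈))
  (λ x∈ y∈ e → Fin.suc-injective (inj (there x∈) (there y∈) (Fin.punchOut-injective (f₀≢ x∈) (f₀≢ y∈) e))))
  where
  f₀≢ : ∀ {x} (x∈ : x ∈ p) → f here ≢ f (there x∈)
  f₀≢ x∈ e = case inj here (there x∈) e of λ ()

module _ {A B : Set} {P : A → Set} {Q : B → Set} {R : A × B → Set}
         (P? : Decidable P) (Q? : Decidable Q) (R? : Decidable R)
         (P×Q⇒R : ∀ {x y} → P x → Q y → R (x , y)) where

  length-filter-pairing : ∀ {x} ys → P x →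
    length (filter Q? ys) ℕ.≤ length (filter R? (List.map (x ,_) ys))
  length-filter-pairing [] Px = ℕ.z≤n
  length-filter-pairing {x} (y ∷ ys) Px with Q? y | R? (x , y)
  ... | yes Qy | yes _  = ℕ.s≤s (length-filter-pairing ys Px)
  ... | yes Qy | no ¬R  = contradiction (P×Q⇒R Px Qy) ¬R
  ... | no _   | yes _  = ℕ.m≤n⇒m≤1+n (length-filter-pairing ys Px)
  ... | no _   | no _   = length-filter-pairing ys Px

  -- An inequality is what the single implication `P×Q⇒R` yields, and e(A,B) has only to be bounded
  -- from below.
  length-filter-× : ∀ xs ys → length (filter P? xs) ℕ.* length (filter Q? ys) ℕ.≤
    length (filter R? (cartesianProduct xs ys))
  length-filter-× [] ys = ℕ.z≤n
  length-filter-× (x ∷ xs) ys = ℕ.≤-trans step (ℕ.≤-reflexive (sym (trans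
      (cong length (List.filter-++ R? (List.map (x ,_) ys) (cartesianProduct xs ys)))
      (List.length-++ (filter R? (List.map (x ,_) ys))))))
    where
    step : length (filter P? (x ∷ xs)) ℕ.* length (filter Q? ys) ℕ.≤
      length (filter R? (List.map (x ,_) ys)) ℕ.+ length (filter R? (cartesianProduct xs ys))
    step with P? x
    ... | yes Px = ℕ.+-mono-≤ (length-filter-pairing ys Px) (length-filter-× xs ys)
    ... | no _   = ℕ.≤-trans (length-filter-× xs ys) (ℕ.m≤n+m _ _)

length-filter-tabulate : ∀ {A : Set} {P : A → Set} (P? : Decidable P) {n} (p : Subset n) (f : Fin n → A) →
  (∀ i → does (P? (f i)) ≡ lookup p i) → length (filter P? (List.tabulate f)) ≡ ∣ p ∣
length-filter-tabulate P? [] f h = refl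
length-filter-tabulate P? (b ∷ p) f h with does (P? (f zero)) | h zero
... | true  | refl = cong suc (length-filter-tabulate P? p (f ∘ suc) (h ∘ suc))
... | false | refl = length-filter-tabulate P? p (f ∘ suc) (h ∘ suc)

does-∈? : ∀ {n} (x : Fin n) (p : Subset n) → does (x ∈? p) ≡ lookup p x
does-∈? zero    (true  ∷ p) = refl
does-∈? zero    (false ∷ p) = refl
does-∈? (suc x) (b ∷ p)     = does-∈? x p

length-filter-∈? : ∀ {n} (p : Subset n) → length (filter (_∈? p) (allFin n)) ≡ ∣ p ∣
length-filter-∈? p = length-filter-tabulate (_∈? p) p (λ i → i) (λ i → does-∈? i p)

∣A∣*∣B∣≤e : ∀ {n} (H : SimpleGraph n) (A B : Subset n) →
  (∀ {a b} → a ∈ A → b ∈ B → SimpleGraph.adjacent H a b ≡ true) →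
  ∣ A ∣ ℕ.* ∣ B ∣ ℕ.≤ e H A B
∣A∣*∣B∣≤e {n} H A B complete = subst₂ (λ x y → x ℕ.* y ℕ.≤ e H A B)
  (length-filter-∈? A) (length-filter-∈? B)
  (length-filter-× (_∈? A) (_∈? B)
    (λ (a , b) → (a ∈? A) ×-dec (b ∈? B) ×-dec (SimpleGraph.adjacent H a b Bool.≟ true))
    (λ a∈ b∈ → a∈ , b∈ , complete a∈ b∈) (allFin n) (allFin n))

∈-tabulate⁺ : ∀ {n} {P : Fin n → Set} (P? : Decidable P) {i} → P i → i ∈ tabulate (does ∘ P?)
∈-tabulate⁺ P? {i} Pi = lookup⇒[]= i _ (trans (lookup∘tabulate (does ∘ P?) i) (dec-true (P? i) Pi))

∈-tabulate⁻ : ∀ {n} {P : Fin n → Set} (P? : Decidable P) {i} → i ∈ tabulate (does ∘ P?) → P i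
∈-tabulate⁻ P? {i} i∈ = dec-true⁻¹ (P? i) (trans (sym (lookup∘tabulate (does ∘ P?) i)) ([]=⇒lookup i∈))

later : ∀ n → ℕ → Subset n
later n d = tabulate (λ j → does (d ℕ.<? toℕ j))

∣later∣ : ∀ n d → ∣ later n d ∣ ≡ n ℕ.∸ suc d
∣later∣ zero    d       = refl
∣later∣ (suc n) (suc d) = ∣later∣ n d
∣later∣ (suc n) zero    = all n
  where
  all : ∀ n → ∣ tabulate {n = n} (λ j → does (0 ℕ.<? toℕ (suc j))) ∣ ≡ n
  all zero    = refl
  all (suc n) = cong suc (all n)

-- Real numbers

eventually₁ : {P Q : ℕ → Set} → (∀ n → P n → Q n) → Eventually P → Eventually Q
eventually₁ f (N , h) = N , λ n l → f n (h n l)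

eventually₂ : {P Q R : ℕ → Set} → (∀ n → P n → Q n → R n) →
  Eventually P → Eventually Q → Eventually R
eventually₂ f (M , g) (N , h) = M ℕ.⊔ N , λ n l →
  f n (g n (ℕ.≤-trans (ℕ.m≤m⊔n M N) l)) (h n (ℕ.≤-trans (ℕ.m≤n⊔m M N) l))

module _ where
  open ℝ
  open RationalLemmas using (0<half; half+half; close; ∣p-q∣≤r⇒p≤q+r; scale; p≤∣p∣)
  open RealLemmas using (bounded)
  open ℚ.≤-Reasoning
  open ℚ-Solver using (solve; _:=_; _:+_; _:*_; _:-_; :-_; con)

  eventually-≤⇒≤ : ∀ {x y} → Eventually (λ n → seq x n ℚ.≤ seq y n) → x ≤ y
  eventually-≤⇒≤ {x} {y} h = mk≤ λ ε 0<ε → eventually₁ (λ n p → begin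
    seq x n          ≤⟨ p ⟩
    seq y n          ≡⟨ sym (ℚ.+-identityʳ _) ⟩
    seq y n ℚ.+ 0ℚ   ≤⟨ ℚ.+-monoʳ-≤ (seq y n) (ℚ.<⇒≤ 0<ε) ⟩
    seq y n ℚ.+ ε    ∎) h

  ≤-antisym : ∀ {x y} → x ≤ y → y ≤ x → x ≃ y
  ≤-antisym (mk≤ h) (mk≤ k) = mk≃ λ ε 0<ε → eventually₂ (λ _ → close) (h ε 0<ε) (k ε 0<ε)

  ≃⇒≤ : ∀ {x y} → x ≃ y → x ≤ y
  ≃⇒≤ (mk≃ h) = mk≤ λ ε 0<ε → eventually₁ (λ _ → ∣p-q∣≤r⇒p≤q+r) (h ε 0<ε)

  ≃-sym : ∀ {x y} → x ≃ y → y ≃ x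
  ≃-sym {x} {y} (mk≃ h) = mk≃ λ ε 0<ε → eventually₁
    (λ n → ℚ.≤-trans (ℚ.≤-reflexive (∣p-q∣≡∣q-p∣ (seq y n) (seq x n)))) (h ε 0<ε)
    where
    ∣p-q∣≡∣q-p∣ : ∀ p q → ℚ.∣ p ℚ.- q ∣ ≡ ℚ.∣ q ℚ.- p ∣
    ∣p-q∣≡∣q-p∣ p q = trans (sym (ℚ.∣-p∣≡∣p∣ (p ℚ.- q)))
      (cong ℚ.∣_∣ (solve 2 (λ p q → :- (p :- q) := q :- p) refl p q))

  ≡⇒≃ : ∀ {x y} → (∀ n → seq x n ≡ seq y n) → x ≃ y
  ≡⇒≃ h = ≤-antisym (eventually-≤⇒≤ (0 , λ n _ → ℚ.≤-reflexive (h n)))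
    (eventually-≤⇒≤ (0 , λ n _ → ℚ.≤-reflexive (sym (h n))))

  ≤-trans : ∀ {x y z} → x ≤ y → y ≤ z → x ≤ z
  ≤-trans {x} {y} {z} (mk≤ h) (mk≤ k) = mk≤ λ ε 0<ε →
    eventually₂ (λ n p q → begin
      seq x n                            ≤⟨ p ⟩
      seq y n ℚ.+ ½ ℚ.* ε                ≤⟨ ℚ.+-monoˡ-≤ (½ ℚ.* ε) q ⟩
      seq z n ℚ.+ ½ ℚ.* ε ℚ.+ ½ ℚ.* ε    ≡⟨ ℚ.+-assoc (seq z n) _ _ ⟩
      seq z n ℚ.+ (½ ℚ.* ε ℚ.+ ½ ℚ.* ε)  ≡⟨ cong (seq z n ℚ.+_) (half+half ε) ⟩
      seq z n ℚ.+ ε                      ∎)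
      (h _ (0<half 0<ε)) (k _ (0<half 0<ε))

  ≃-trans : ∀ {x y z} → x ≃ y → y ≃ z → x ≃ z
  ≃-trans h k = ≤-antisym (≤-trans (≃⇒≤ h) (≃⇒≤ k))
    (≤-trans (≃⇒≤ (≃-sym k)) (≃⇒≤ (≃-sym h)))

  ≃-isEquivalence : IsEquivalence _≃_
  ≃-isEquivalence = record { refl = ≡⇒≃ (λ _ → refl) ; sym = ≃-sym ; trans = ≃-trans }

  ≤-modulus : ∀ x ε → 0ℚ ℚ.< ε →
    Σ[ N ∈ ℕ ] (∀ m n → N ℕ.≤ m → N ℕ.≤ n → seq x m ℚ.≤ seq x n ℚ.+ ε)
  ≤-modulus x ε 0<ε = let N , f = cauchy x ε 0<ε in N , λ m n k l →
    ∣p-q∣≤r⇒p≤q+r {seq x m} {seq x n} (f m n k l)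

  -- The order is undecidable, so this replaces the case distinction x ≤ y or y < x.
  ≮⇒≥ : ∀ {x y} → ¬ (y < x) → x ≤ y
  ≮⇒≥ {x} {y} y≮x = mk≤ below
    where
    below : ∀ ε → 0ℚ ℚ.< ε → Eventually (λ n → seq x n ℚ.≤ seq y n ℚ.+ ε)
    below ε 0<ε = M ℕ.⊔ N , le
      where
      -- If `x` exceeded `y` by more than ε at one late index, each sequence could move by at most
      -- ε/4 from there on. A gap of ε/2 would then persist and witness `y < x`.
      δ = ½ ℚ.* (½ ℚ.* ε)
      0<δ : 0ℚ ℚ.< δ
      0<δ = 0<half (0<half 0<ε)
      M = proj₁ (≤-modulus x δ 0<δ)
      N = proj₁ (≤-modulus y δ 0<δ)
      le : ∀ n → M ℕ.⊔ N ℕ.≤ n → seq x n ℚ.≤ seq y n ℚ.+ ε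
      le n l with seq x n ℚ.≤? seq y n ℚ.+ ε
      ... | yes p = p
      ... | no ¬p = contradiction (mk< (½ ℚ.* ε) (0<half 0<ε) (M ℕ.⊔ N , sep)) y≮x
        where
        sep : ∀ m → M ℕ.⊔ N ℕ.≤ m → seq y m ℚ.+ ½ ℚ.* ε ℚ.≤ seq x m
        sep m k = begin
          seq y m ℚ.+ ½ ℚ.* ε
            ≡⟨ solve 3 (λ a e d → a :+ e := a :+ (e :+ d :- d)) refl
                 (seq y m) (½ ℚ.* ε) δ ⟩
          seq y m ℚ.+ (½ ℚ.* ε ℚ.+ δ ℚ.- δ)
            ≤⟨ ℚ.+-monoˡ-≤ (½ ℚ.* ε ℚ.+ δ ℚ.- δ) (proj₂ (≤-modulus y δ 0<δ) m n
                 (ℕ.≤-trans (ℕ.m≤n⊔m M N) k) (ℕ.≤-trans (ℕ.m≤n⊔m M N) l)) ⟩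
          seq y n ℚ.+ δ ℚ.+ (½ ℚ.* ε ℚ.+ δ ℚ.- δ)
            ≡⟨ solve 2 (λ b e → let d = con ½ :* (con ½ :* e) in
                 b :+ d :+ (con ½ :* e :+ d :- d) := b :+ e :- d) refl (seq y n) ε ⟩
          seq y n ℚ.+ ε ℚ.- δ
            ≤⟨ ℚ.+-monoˡ-≤ (ℚ.- δ) (ℚ.<⇒≤ (ℚ.≰⇒> ¬p)) ⟩
          seq x n ℚ.- δ
            ≤⟨ ℚ.+-monoˡ-≤ (ℚ.- δ) (proj₂ (≤-modulus x δ 0<δ) n m
                 (ℕ.≤-trans (ℕ.m≤m⊔n M N) l) (ℕ.≤-trans (ℕ.m≤m⊔n M N) k)) ⟩
          seq x m ℚ.+ δ ℚ.- δ
            ≡⟨ solve 2 (λ a d → a :+ d :- d := a) refl (seq x m) δ ⟩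
          seq x m  ∎

  <⇒≤ : ∀ {x y} → x < y → x ≤ y
  <⇒≤ {x} {y} (mk< g 0<g h) = mk≤ λ ε 0<ε → eventually₁ (λ n p → begin
    seq x n          ≡⟨ sym (ℚ.+-identityʳ _) ⟩
    seq x n ℚ.+ 0ℚ   ≤⟨ ℚ.+-monoʳ-≤ (seq x n) (ℚ.<⇒≤ 0<g) ⟩
    seq x n ℚ.+ g    ≤⟨ p ⟩
    seq y n          ≡⟨ sym (ℚ.+-identityʳ _) ⟩
    seq y n ℚ.+ 0ℚ   ≤⟨ ℚ.+-monoʳ-≤ (seq y n) (ℚ.<⇒≤ 0<ε) ⟩
    seq y n ℚ.+ ε    ∎) h

  -- Only half of the gap survives: `≤` is known up to an arbitrary positive tolerance, and the
  -- other half of the gap pays for it.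
  <-≤-trans : ∀ {x y z} → x < y → y ≤ z → x < z
  <-≤-trans {x} {y} {z} (mk< g 0<g h) (mk≤ k) = mk< (½ ℚ.* g) (0<half 0<g)
    (eventually₂ (λ n p q → begin
      seq x n ℚ.+ ½ ℚ.* g
        ≡⟨ solve 2 (λ a g → a :+ con ½ :* g := a :+ g :- con ½ :* g) refl (seq x n) g ⟩
      seq x n ℚ.+ g ℚ.- ½ ℚ.* g              ≤⟨ ℚ.+-monoˡ-≤ _ (ℚ.≤-trans p q) ⟩
      seq z n ℚ.+ ½ ℚ.* g ℚ.- ½ ℚ.* g
        ≡⟨ solve 2 (λ a g → a :+ g :- g := a) refl (seq z n) (½ ℚ.* g) ⟩
      seq z n                                ∎) h (k _ (0<half 0<g)))

  ≤-<-trans : ∀ {x y z} → x ≤ y → y < z → x < z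
  ≤-<-trans {x} {y} {z} (mk≤ k) (mk< g 0<g h) = mk< (½ ℚ.* g) (0<half 0<g)
    (eventually₂ (λ n p q → begin
      seq x n ℚ.+ ½ ℚ.* g                    ≤⟨ ℚ.+-monoˡ-≤ _ p ⟩
      seq y n ℚ.+ ½ ℚ.* g ℚ.+ ½ ℚ.* g        ≡⟨ ℚ.+-assoc (seq y n) _ _ ⟩
      seq y n ℚ.+ (½ ℚ.* g ℚ.+ ½ ℚ.* g)      ≡⟨ cong (seq y n ℚ.+_) (half+half g) ⟩
      seq y n ℚ.+ g                          ≤⟨ q ⟩
      seq z n                                ∎) (k _ (0<half 0<g)) h)

  <-irrefl : ∀ {x} → ¬ (x < x)
  <-irrefl {x} (mk< g 0<g (N , h)) = ℚ.<-irrefl refl (ℚ.<-≤-trans (begin-strict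
    seq x N          ≡⟨ sym (ℚ.+-identityʳ _) ⟩
    seq x N ℚ.+ 0ℚ   <⟨ ℚ.+-monoʳ-< (seq x N) 0<g ⟩
    seq x N ℚ.+ g    ∎) (h N ℕ.≤-refl))

  opaque
    unfolding _+_ _*_ -_ fromℚ

    +-mono-≤ : ∀ {x y u v} → x ≤ y → u ≤ v → x + u ≤ y + v
    +-mono-≤ {x} {y} {u} {v} (mk≤ h) (mk≤ k) = mk≤ λ ε 0<ε → eventually₂ (λ n p q → begin
      seq x n ℚ.+ seq u n                                  ≤⟨ ℚ.+-mono-≤ p q ⟩
      (seq y n ℚ.+ ½ ℚ.* ε) ℚ.+ (seq v n ℚ.+ ½ ℚ.* ε)
        ≡⟨ solve 3 (λ a b e → (a :+ con ½ :* e) :+ (b :+ con ½ :* e) := a :+ b :+ e) refl (seq y n) (seq v n) ε ⟩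
      seq y n ℚ.+ seq v n ℚ.+ ε                            ∎)
      (h _ (0<half 0<ε)) (k _ (0<half 0<ε))

    neg-mono-≤ : ∀ {x y} → x ≤ y → - y ≤ - x
    neg-mono-≤ {x} {y} (mk≤ h) = mk≤ λ ε 0<ε → eventually₁ (λ n p → begin
      ℚ.- seq y n
        ≡⟨ solve 3 (λ a b e → :- b := a :+ (:- a :- b)) refl (seq x n) (seq y n) ε ⟩
      seq x n ℚ.+ (ℚ.- seq x n ℚ.- seq y n)              ≤⟨ ℚ.+-monoˡ-≤ _ p ⟩
      seq y n ℚ.+ ε ℚ.+ (ℚ.- seq x n ℚ.- seq y n)
        ≡⟨ solve 3 (λ a b e → b :+ e :+ (:- a :- b) := :- a :+ e) refl (seq x n) (seq y n) ε ⟩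
      ℚ.- seq x n ℚ.+ ε                                  ∎) (h ε 0<ε)

    *-nonneg : ∀ {x y} → 0ℝ ≤ x → 0ℝ ≤ y → 0ℝ ≤ x * y
    *-nonneg {x} {y} (mk≤ h) (mk≤ k) = mk≤ below
      where
      ⊓-pos : ∀ {p q} → 0ℚ ℚ.< p → 0ℚ ℚ.< q → 0ℚ ℚ.< p ℚ.⊓ q
      ⊓-pos {p} {q} 0<p 0<q with ℚ.⊓-sel p q
      ... | inj₁ e = subst (0ℚ ℚ.<_) (sym e) 0<p
      ... | inj₂ e = subst (0ℚ ℚ.<_) (sym e) 0<q
      below : ∀ ε → 0ℚ ℚ.< ε → Eventually (λ n → 0ℚ ℚ.≤ seq x n ℚ.* seq y n ℚ.+ ε)
      below ε 0<ε =
        let a , 0<a , bx = bounded {seq x} (cauchy x)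
            b , 0<b , by = bounded {seq y} (cauchy y)
            δ , 0<δ , eq = scale (a ℚ.+ b ℚ.+ 1ℚ)
              (ℚ.+-mono-< (ℚ.+-mono-< 0<a 0<b) (ℚ.positive⁻¹ 1ℚ)) ε 0<ε
            -- Expanding `(x + δ′) * (y + δ′) ≥ 0` leaves the error `δ′ * (x + y + δ′)`. The cap at
            -- 1 bounds the second factor by `a + b + 1`, and δ is ε divided by that number.
            δ′ = δ ℚ.⊓ 1ℚ
            0<δ′ = ⊓-pos 0<δ (ℚ.positive⁻¹ 1ℚ)
        in eventually₂ (λ { n (p , q) (r , s) → begin
          0ℚ  ≤⟨ ℚ.≤-trans (ℚ.≤-reflexive (sym (ℚ.*-zeroˡ 0ℚ)))
                  (RationalLemmas.*-mono-≤ ℚ.≤-refl q p q) ⟩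
          (seq x n ℚ.+ δ′) ℚ.* (seq y n ℚ.+ δ′)
            ≡⟨ solve 3 (λ x y d → (x :+ d) :* (y :+ d) := x :* y :+ d :* (x :+ y :+ d)) refl
                 (seq x n) (seq y n) δ′ ⟩
          seq x n ℚ.* seq y n ℚ.+ δ′ ℚ.* (seq x n ℚ.+ seq y n ℚ.+ δ′)
            ≤⟨ ℚ.+-monoʳ-≤ (seq x n ℚ.* seq y n) (ℚ.≤-trans
                 (ℚ.*-monoˡ-≤-nonNeg δ′ {{ℚ.nonNegative (ℚ.<⇒≤ 0<δ′)}}
                   (ℚ.+-mono-≤ (ℚ.+-mono-≤ (ℚ.≤-trans (p≤∣p∣ _) r) (ℚ.≤-trans (p≤∣p∣ _) s)) (ℚ.p⊓q≤q δ 1ℚ)))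
                 (ℚ.*-monoʳ-≤-nonNeg (a ℚ.+ b ℚ.+ 1ℚ)
                   {{ℚ.nonNegative (ℚ.+-mono-≤ (ℚ.+-mono-≤ (ℚ.<⇒≤ 0<a) (ℚ.<⇒≤ 0<b)) (ℚ.nonNegative⁻¹ 1ℚ))}}
                   (ℚ.p⊓q≤p δ 1ℚ))) ⟩
          seq x n ℚ.* seq y n ℚ.+ δ ℚ.* (a ℚ.+ b ℚ.+ 1ℚ)
            ≡⟨ cong (seq x n ℚ.* seq y n ℚ.+_) (trans (ℚ.*-comm δ _) eq) ⟩
          seq x n ℚ.* seq y n ℚ.+ ε  ∎ })
          (eventually₂ (λ _ → _,_) (h δ′ 0<δ′) (k δ′ 0<δ′))
          (eventually₂ (λ _ → _,_) bx by)

    *-congʳ : ∀ {x y z} → y ≃ z → x * y ≃ x * z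
    *-congʳ {x} {y} {z} (mk≃ h) = mk≃ λ ε 0<ε →
      let b , 0<b , bx = bounded {seq x} (cauchy x)
          δ , 0<δ , eq = scale b 0<b ε 0<ε
      in eventually₂ (λ n p q → begin
        ℚ.∣ seq x n ℚ.* seq y n ℚ.- seq x n ℚ.* seq z n ∣
          ≡⟨ cong ℚ.∣_∣ (solve 3 (λ x y z → x :* y :- x :* z := x :* (y :- z)) refl (seq x n) (seq y n) (seq z n)) ⟩
        ℚ.∣ seq x n ℚ.* (seq y n ℚ.- seq z n) ∣          ≡⟨ ℚ.∣p*q∣≡∣p∣*∣q∣ (seq x n) _ ⟩
        ℚ.∣ seq x n ∣ ℚ.* ℚ.∣ seq y n ℚ.- seq z n ∣
          ≤⟨ RationalLemmas.*-mono-≤ (ℚ.0≤∣p∣ _) (ℚ.<⇒≤ 0<δ) p q ⟩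
        b ℚ.* δ  ≡⟨ eq ⟩
        ε  ∎) bx (h δ 0<δ)

    *-pos : ∀ {x y} → 0ℝ < x → 0ℝ < y → 0ℝ < x * y
    *-pos {x} {y} (mk< g 0<g h) (mk< f 0<f k) = mk< (g ℚ.* f)
      (ℚ.positive⁻¹ (g ℚ.* f) {{ℚ.pos*pos⇒pos g {{ℚ.positive 0<g}} f {{ℚ.positive 0<f}}}})
      (eventually₂ (λ n p q → begin
        0ℚ ℚ.+ g ℚ.* f  ≡⟨ solve 2 (λ g f → con 0ℚ :+ g :* f := (con 0ℚ :+ g) :* (con 0ℚ :+ f)) refl g f ⟩
        (0ℚ ℚ.+ g) ℚ.* (0ℚ ℚ.+ f)
          ≤⟨ RationalLemmas.*-mono-≤ (ℚ.+-mono-≤ (ℚ.≤-refl {0ℚ}) (ℚ.<⇒≤ 0<g))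
              (ℚ.≤-trans (ℚ.+-mono-≤ (ℚ.≤-refl {0ℚ}) (ℚ.<⇒≤ 0<f)) q) p q ⟩
        seq x n ℚ.* seq y n  ∎) h k)

    +-monoˡ-< : ∀ {x y} z → x < y → x + z < y + z
    +-monoˡ-< {x} {y} z (mk< g 0<g h) = mk< g 0<g (eventually₁ (λ n p → begin
      seq x n ℚ.+ seq z n ℚ.+ g
        ≡⟨ solve 3 (λ x z g → x :+ z :+ g := x :+ g :+ z) refl (seq x n) (seq z n) g ⟩
      seq x n ℚ.+ g ℚ.+ seq z n    ≤⟨ ℚ.+-monoˡ-≤ (seq z n) p ⟩
      seq y n ℚ.+ seq z n          ∎) h)

    fromℚ-mono-≤ : ∀ {p q} → p ℚ.≤ q → fromℚ p ≤ fromℚ q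
    fromℚ-mono-≤ h = eventually-≤⇒≤ (0 , λ _ _ → h)

    fromℚ-mono-< : ∀ {p q} → p ℚ.< q → fromℚ p < fromℚ q
    fromℚ-mono-< {p} {q} h = mk< (q ℚ.- p)
      (begin-strict
        0ℚ        ≡⟨ sym (ℚ.+-inverseʳ p) ⟩
        p ℚ.- p   <⟨ ℚ.+-monoˡ-< (ℚ.- p) h ⟩
        q ℚ.- p   ∎)
      (0 , λ _ _ → ℚ.≤-reflexive (solve 2 (λ p q → p :+ (q :- p) := q) refl p q))

    fromℚ-+ : ∀ p q → fromℚ (p ℚ.+ q) ≃ fromℚ p + fromℚ q
    fromℚ-+ p q = ≡⇒≃ (λ _ → refl)

    fromℚ-* : ∀ p q → fromℚ (p ℚ.* q) ≃ fromℚ p * fromℚ q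
    fromℚ-* p q = ≡⇒≃ (λ _ → refl)

    fromℚ-neg : ∀ p → fromℚ (ℚ.- p) ≃ - fromℚ p
    fromℚ-neg p = ≡⇒≃ (λ _ → refl)

    rational-bounds : ∀ x → Σ[ q ∈ ℚ ] (x ≤ fromℚ q + 1ℝ × fromℚ q ≤ x + 1ℝ)
    rational-bounds x = let N , f = ≤-modulus x 1ℚ (ℚ.positive⁻¹ 1ℚ) in seq x N ,
      eventually-≤⇒≤ (N , λ n l → f n N l ℕ.≤-refl) ,
      eventually-≤⇒≤ (N , λ n l → f N n ℕ.≤-refl l)

    +-assoc : ∀ x y z → (x + y) + z ≃ x + (y + z)
    +-assoc x y z = ≡⇒≃ λ n → ℚ.+-assoc (seq x n) (seq y n) (seq z n)
    +-comm : ∀ x y → x + y ≃ y + x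
    +-comm x y = ≡⇒≃ λ n → ℚ.+-comm (seq x n) (seq y n)
    +-identityˡ : ∀ x → 0ℝ + x ≃ x
    +-identityˡ x = ≡⇒≃ λ n → ℚ.+-identityˡ (seq x n)
    +-inverseˡ : ∀ x → - x + x ≃ 0ℝ
    +-inverseˡ x = ≡⇒≃ λ n → ℚ.+-inverseˡ (seq x n)
    *-assoc : ∀ x y z → (x * y) * z ≃ x * (y * z)
    *-assoc x y z = ≡⇒≃ λ n → ℚ.*-assoc (seq x n) (seq y n) (seq z n)
    *-comm : ∀ x y → x * y ≃ y * x
    *-comm x y = ≡⇒≃ λ n → ℚ.*-comm (seq x n) (seq y n)
    *-identityˡ : ∀ x → 1ℝ * x ≃ x
    *-identityˡ x = ≡⇒≃ λ n → ℚ.*-identityˡ (seq x n)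
    *-distribˡ-+ : ∀ x y z → x * (y + z) ≃ x * y + x * z
    *-distribˡ-+ x y z = ≡⇒≃ λ n → ℚ.*-distribˡ-+ (seq x n) (seq y n) (seq z n)

-- The commutative ring of real numbers and its order

ℝ-commutativeRing : CommutativeRing 0ℓ 0ℓ
ℝ-commutativeRing = record
  { Carrier = ℝ ; _≈_ = _≃_ ; _+_ = _+_ ; _*_ = _*_ ; -_ = -_ ; 0# = 0ℝ ; 1# = 1ℝ
  ; isCommutativeRing = record
    { isRing = record
      { +-isAbelianGroup = record
        { isGroup = record
          { isMonoid = record
            { isSemigroup = record
              { isMagma = record { isEquivalence = ≃-isEquivalence ; ∙-cong = +-cong }
              ; assoc = +-assoc }
            ; identity = comm∧idˡ⇒id +-comm +-identityˡ }
          ; inverse = comm∧invˡ⇒inv +-comm +-inverseˡ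
          ; ⁻¹-cong = λ h → ≤-antisym (neg-mono-≤ (≃⇒≤ (≃-sym h))) (neg-mono-≤ (≃⇒≤ h)) }
        ; comm = +-comm }
      ; *-cong = λ {x} {y} {u} {v} h k → ≃-trans (*-congʳ k)
          (≃-trans (*-comm x v) (≃-trans (*-congʳ h) (*-comm v y)))
      ; *-assoc = *-assoc
      ; *-identity = comm∧idˡ⇒id *-comm *-identityˡ
      ; distrib = comm∧distrˡ⇒distr +-cong *-comm *-distribˡ-+ }
    ; *-comm = *-comm } }
  where
  +-cong : ∀ {x y u v} → x ≃ y → u ≃ v → x + u ≃ y + v
  +-cong h k = ≤-antisym (+-mono-≤ (≃⇒≤ h) (≃⇒≤ k)) (+-mono-≤ (≃⇒≤ (≃-sym h)) (≃⇒≤ (≃-sym k)))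
  S : Setoid 0ℓ 0ℓ
  S = record { isEquivalence = ≃-isEquivalence }
  open import Algebra.Consequences.Setoid S

open CommutativeRing ℝ-commutativeRing using (+-cong; *-cong; *-identityʳ; zeroʳ)
  renaming (refl to ≃-refl; reflexive to ≃-reflexive; -‿cong to neg-cong)

-- The ring solver compares coefficients, and equality on ℝ offers no decision procedure; with
-- rational coefficients the comparison takes place in ℚ.
ℚ-morphism : CommutativeRing.rawRing ℚ.+-*-commutativeRing
  -Raw-AlmostCommutative⟶ fromCommutativeRing ℝ-commutativeRing
ℚ-morphism = record
  { ⟦_⟧ = fromℚ ; +-homo = fromℚ-+ ; *-homo = fromℚ-* ; -‿homo = fromℚ-neg
  ; 0-homo = ≃-refl ; 1-homo = ≃-refl }

fromℚ-≃? : ∀ p q → Maybe (fromℚ p ≃ fromℚ q)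
fromℚ-≃? p q with p ℚ.≟ q
... | yes eq = just (≃-reflexive (cong fromℚ eq))
... | no  _  = nothing

module ℝ-Solver = Algebra.Solver.Ring (CommutativeRing.rawRing ℚ.+-*-commutativeRing)
  (fromCommutativeRing ℝ-commutativeRing) ℚ-morphism fromℚ-≃?

≤-isPreorder : IsPreorder _≃_ _≤_
≤-isPreorder = record { isEquivalence = ≃-isEquivalence ; reflexive = ≃⇒≤ ; trans = ≤-trans }

<-trans : ∀ {x y z} → x < y → y < z → x < z
<-trans h k = <-≤-trans h (<⇒≤ k)

<-asym : ∀ {x y} → x < y → ¬ (y < x)
<-asym h k = <-irrefl (<-trans h k)

<-resp-≃ : _<_ Respects₂ _≃_
<-resp-≃ = (λ e h → <-≤-trans h (≃⇒≤ e)) , (λ e h → ≤-<-trans (≃⇒≤ (≃-sym e)) h)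

module ≤-Reasoning = Relation.Binary.Reasoning.Base.Triple
  ≤-isPreorder <-asym <-trans <-resp-≃ <⇒≤ <-≤-trans ≤-<-trans

open ≤-Reasoning
open ℝ-Solver using (solve; _:=_; _:+_; _:*_; _:-_; :-_; con)

≤-refl : ∀ {x} → x ≤ x
≤-refl = ≃⇒≤ ≃-refl

≤⇒0≤- : ∀ {x y} → x ≤ y → 0ℝ ≤ y - x
≤⇒0≤- {x} {y} h = begin
  0ℝ     ≈⟨ solve 1 (λ x → con 0ℚ := x :- x) ≃-refl x ⟩
  x - x  ≤⟨ +-mono-≤ h ≤-refl ⟩
  y - x  ∎

0≤-⇒≤ : ∀ {x y} → 0ℝ ≤ y - x → x ≤ y
0≤-⇒≤ {x} {y} h = begin
  x            ≈⟨ solve 1 (λ x → x := con 0ℚ :+ x) ≃-refl x ⟩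
  0ℝ + x       ≤⟨ +-mono-≤ h ≤-refl ⟩
  y - x + x    ≈⟨ solve 2 (λ x y → y :- x :+ x := y) ≃-refl x y ⟩
  y            ∎

<⇒0<- : ∀ {x y} → x < y → 0ℝ < y - x
<⇒0<- {x} {y} h = begin-strict
  0ℝ     ≈⟨ solve 1 (λ x → con 0ℚ := x :- x) ≃-refl x ⟩
  x - x  <⟨ +-monoˡ-< (- x) h ⟩
  y - x  ∎

0<-⇒< : ∀ {x y} → 0ℝ < y - x → x < y
0<-⇒< {x} {y} h = begin-strict
  x            ≈⟨ solve 1 (λ x → x := con 0ℚ :+ x) ≃-refl x ⟩
  0ℝ + x       <⟨ +-monoˡ-< x h ⟩
  y - x + x    ≈⟨ solve 2 (λ x y → y :- x :+ x := y) ≃-refl x y ⟩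
  y            ∎

*-monoˡ-≤ : ∀ {x y z} → 0ℝ ≤ z → x ≤ y → z * x ≤ z * y
*-monoˡ-≤ {x} {y} {z} 0≤z h = 0≤-⇒≤ (begin
  0ℝ             ≤⟨ *-nonneg 0≤z (≤⇒0≤- h) ⟩
  z * (y - x)    ≈⟨ solve 3 (λ x y z → z :* (y :- x) := z :* y :- z :* x) ≃-refl x y z ⟩
  z * y - z * x  ∎)

*-monoˡ-< : ∀ {x y z} → 0ℝ < z → x < y → z * x < z * y
*-monoˡ-< {x} {y} {z} 0<z h = 0<-⇒< (begin-strict
  0ℝ             <⟨ *-pos 0<z (<⇒0<- h) ⟩
  z * (y - x)    ≈⟨ solve 3 (λ x y z → z :* (y :- x) := z :* y :- z :* x) ≃-refl x y z ⟩
  z * y - z * x  ∎)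

*-mono-≤ : ∀ {x y u v} → 0ℝ ≤ x → 0ℝ ≤ v → x ≤ y → u ≤ v → x * u ≤ y * v
*-mono-≤ {x} {y} {u} {v} 0≤x 0≤v h k = begin
  x * u  ≤⟨ *-monoˡ-≤ 0≤x k ⟩
  x * v  ≈⟨ *-comm x v ⟩
  v * x  ≤⟨ *-monoˡ-≤ 0≤v h ⟩
  v * y  ≈⟨ *-comm v y ⟩
  y * v  ∎

-- The sign of `x` cannot be inspected, so the argument is nested by contradiction. Assume
-- `x * x < 0`. Then `x < 0` is impossible, because `x * x` is also the square of the nonnegative
-- `0 - x`; hence `0 ≤ x`, and so `0 ≤ x * x` after all.
0≤square : ∀ x → 0ℝ ≤ x * x
0≤square x = ≮⇒≥ λ x²<0 → <-irrefl (≤-<-trans (0≤x² x²<0) x²<0)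
  where
  0≤x² : x * x < 0ℝ → 0ℝ ≤ x * x
  0≤x² x²<0 = *-nonneg 0≤x 0≤x
    where
    0≤x : 0ℝ ≤ x
    0≤x = ≮⇒≥ λ x<0 → <-irrefl (begin-strict
      0ℝ             ≤⟨ *-nonneg (≤⇒0≤- (<⇒≤ x<0)) (≤⇒0≤- (<⇒≤ x<0)) ⟩
      (0ℝ - x) * (0ℝ - x)
        ≈⟨ solve 1 (λ x → (con 0ℚ :- x) :* (con 0ℚ :- x) := x :* x) ≃-refl x ⟩
      x * x          <⟨ x²<0 ⟩
      0ℝ             ∎)

*-cancelˡ-≤ : ∀ {x y z} → 0ℝ < z → z * x ≤ z * y → x ≤ y
*-cancelˡ-≤ 0<z h = ≮⇒≥ λ k → <-irrefl (<-≤-trans (*-monoˡ-< 0<z k) h)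

square-cancel-≤ : ∀ {x y} → 0ℝ < y → x * x ≤ y * y → x ≤ y
square-cancel-≤ {x} {y} 0<y h = ≮⇒≥ λ y<x → <-irrefl (begin-strict
  y * y  <⟨ *-monoˡ-< 0<y y<x ⟩
  y * x  ≈⟨ *-comm y x ⟩
  x * y  <⟨ *-monoˡ-< (<-≤-trans 0<y (<⇒≤ y<x)) y<x ⟩
  x * x  ≤⟨ h ⟩
  y * y  ∎)

private
  toℚᵘ-/1 : ∀ n → ℚ.toℚᵘ (+ n ℚ./ 1) ℚᵘ.≃ ℚᵘ.mkℚᵘ (+ n) 0
  toℚᵘ-/1 n = ℚ.toℚᵘ-fromℚᵘ (ℚᵘ.mkℚᵘ (+ n) 0)

fromℕ-+ : ∀ m n → fromℕ (m ℕ.+ n) ≃ fromℕ m + fromℕ n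
fromℕ-+ m n = ≃-trans (≃-reflexive (cong fromℚ (ℚ.toℚᵘ-injective (ℚᵘ.≃-trans (toℚᵘ-/1 (m ℕ.+ n))
  (ℚᵘ.≃-sym (ℚᵘ.≃-trans (ℚ.toℚᵘ-homo-+ (+ m ℚ./ 1) (+ n ℚ./ 1))
    (ℚᵘ.≃-trans (ℚᵘ.+-cong (toℚᵘ-/1 m) (toℚᵘ-/1 n))
      (ℚᵘ.*≡* (cong (ℤ._* (+ 1)) (cong₂ ℤ._+_ (ℤ.*-identityʳ (+ m)) (ℤ.*-identityʳ (+ n)))))))))))) (fromℚ-+ _ _)

fromℕ-* : ∀ m n → fromℕ (m ℕ.* n) ≃ fromℕ m * fromℕ n
fromℕ-* m n = ≃-trans (≃-reflexive (cong fromℚ (ℚ.toℚᵘ-injective (ℚᵘ.≃-trans (toℚᵘ-/1 (m ℕ.* n))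
  (ℚᵘ.≃-sym (ℚᵘ.≃-trans (ℚ.toℚᵘ-homo-* (+ m ℚ./ 1) (+ n ℚ./ 1))
    (ℚᵘ.≃-trans (ℚᵘ.*-cong (toℚᵘ-/1 m) (toℚᵘ-/1 n))
      (ℚᵘ.*≡* (cong (ℤ._* (+ 1)) (sym (ℤ.pos-* m n))))))))))) (fromℚ-* _ _)

fromℕ-mono-≤ : ∀ {m n} → m ℕ.≤ n → fromℕ m ≤ fromℕ n
fromℕ-mono-≤ {m} {n} h = fromℚ-mono-≤ (ℚ.toℚᵘ-cancel-≤
  (ℚᵘ.≤-respʳ-≃ (ℚᵘ.≃-sym (toℚᵘ-/1 n)) (ℚᵘ.≤-respˡ-≃ (ℚᵘ.≃-sym (toℚᵘ-/1 m))
    (ℚᵘ.*≤* (ℤ.*-monoʳ-≤-nonNeg (+ 1) (ℤ.+≤+ h))))))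

fromℕ-mono-< : ∀ {m n} → m ℕ.< n → fromℕ m < fromℕ n
fromℕ-mono-< {m} {n} h = fromℚ-mono-< (ℚ.toℚᵘ-cancel-<
  (ℚᵘ.<-respʳ-≃ (ℚᵘ.≃-sym (toℚᵘ-/1 n)) (ℚᵘ.<-respˡ-≃ (ℚᵘ.≃-sym (toℚᵘ-/1 m))
    (ℚᵘ.*<* (ℤ.*-monoʳ-<-pos (+ 1) (ℤ.+<+ h))))))

0≤fromℕ : ∀ n → 0ℝ ≤ fromℕ n
0≤fromℕ n = fromℕ-mono-≤ {0} {n} ℕ.z≤n

open RationalLemmas using (unit; grid; grid-toℚᵘ; q<bound; eventually-unit≤; 0<half; half+half; 0≤grid)

0≤1 : 0ℝ ≤ 1ℝ
0≤1 = fromℕ-mono-≤ {0} {1} ℕ.z≤n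

fromℕ-suc : ∀ n → fromℕ (suc n) ≃ 1ℝ + fromℕ n
fromℕ-suc n = fromℕ-+ 1 n

fromℕ-cancel-< : ∀ {m n} → fromℕ m < fromℕ n → m ℕ.< n
fromℕ-cancel-< {m} {n} h = ℕ.≰⇒> λ n≤m → <-irrefl (<-≤-trans h (fromℕ-mono-≤ {n} {m} n≤m))

x≤x+y : ∀ {x y} → 0ℝ ≤ y → x ≤ x + y
x≤x+y {x} {y} 0≤y = begin
  x        ≈⟨ solve 1 (λ x → x := x :+ con 0ℚ) ≃-refl x ⟩
  x + 0ℝ   ≤⟨ +-mono-≤ ≤-refl 0≤y ⟩
  x + y    ∎

-- The floor of a real number is not computable, but a rational `q` within 1 of `x` can be rounded
-- by a decidable downward search. The bounds add up the error 1 of `q` and the rounding error 1;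
-- `0 ≤ x` covers a search that descends to 0.
integer-bounds : ∀ x → 0ℝ ≤ x → Σ[ s ∈ ℕ ] (x ≤ fromℕ s + fromℕ 2 × fromℕ s ≤ x + 1ℝ)
integer-bounds x 0≤x with rational-bounds x
... | q , x≤q+1 , q≤x+1 = search (suc ℤ.∣ ℚ.↥ q ∣) (ℚ.<⇒≤ (subst (q ℚ.<_) (grid-0 _) (q<bound q 0)))
  where
  grid-0 : ∀ j → grid 0 (1 ℕ.* j) ≡ + j ℚ./ 1
  grid-0 j = trans (cong (grid 0) (ℕ.*-identityˡ j))
    (ℚ.toℚᵘ-injective (ℚᵘ.≃-trans (grid-toℚᵘ 0 j) (ℚᵘ.≃-sym (ℚ.toℚᵘ-fromℚᵘ (ℚᵘ.mkℚᵘ (+ j) 0)))))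
  search : ∀ B → q ℚ.≤ + B ℚ./ 1 → Σ[ s ∈ ℕ ] (x ≤ fromℕ s + fromℕ 2 × fromℕ s ≤ x + 1ℝ)
  search zero q≤0 = 0 ,
    (begin
      x                 ≤⟨ x≤q+1 ⟩
      fromℚ q + 1ℝ      ≤⟨ +-mono-≤ (fromℚ-mono-≤ q≤0) (fromℕ-mono-≤ {1} {2} (ℕ.s≤s ℕ.z≤n)) ⟩
      0ℝ + fromℕ 2      ∎) ,
    ≤-trans 0≤x (x≤x+y 0≤1)
  search (suc B) q≤ with q ℚ.≤? + B ℚ./ 1
  ... | yes q≤B = search B q≤B
  ... | no  q≰B = B ,
    (begin
      x                       ≤⟨ x≤q+1 ⟩
      fromℚ q + 1ℝ            ≤⟨ +-mono-≤ (fromℚ-mono-≤ q≤) ≤-refl ⟩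
      fromℕ (suc B) + 1ℝ      ≈⟨ +-cong (fromℕ-suc B) ≃-refl ⟩
      1ℝ + fromℕ B + 1ℝ       ≈⟨ solve 1 (λ b → con 1ℚ :+ b :+ con 1ℚ := b :+ con (1ℚ ℚ.+ 1ℚ)) ≃-refl (fromℕ B) ⟩
      fromℕ B + fromℕ 2       ∎) ,
    ≤-trans (fromℚ-mono-≤ (ℚ.<⇒≤ (ℚ.≰⇒> q≰B))) q≤x+1

unit-inverse : ∀ k → fromℚ (unit k) * fromℕ (suc k) ≃ 1ℝ
unit-inverse k = ≃-trans (≃-sym (fromℚ-* (unit k) (+ suc k ℚ./ 1))) (≃-reflexive (cong fromℚ
  (ℚ.toℚᵘ-injective (ℚᵘ.≃-trans (ℚ.toℚᵘ-homo-* (unit k) (+ suc k ℚ./ 1))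
    (ℚᵘ.≃-trans (ℚᵘ.*-cong (grid-toℚᵘ k 1) (ℚ.toℚᵘ-fromℚᵘ (ℚᵘ.mkℚᵘ (+ suc k) 0)))
      (ℚᵘ.*≡* (ℤ.*-assoc (+ 1) (+ suc k) (+ 1))))))))

fraction-cancel : ∀ d n .{{_ : NonZero n}} → fromℚ (+ d ℚ./ n) * fromℕ n ≃ fromℕ d
fraction-cancel d (suc n) = ≃-trans (≃-sym (fromℚ-* (+ d ℚ./ suc n) (+ suc n ℚ./ 1))) (≃-reflexive (cong fromℚ
  (ℚ.toℚᵘ-injective (ℚᵘ.≃-trans (ℚ.toℚᵘ-homo-* (+ d ℚ./ suc n) (+ suc n ℚ./ 1))
    (ℚᵘ.≃-trans (ℚᵘ.*-cong (ℚ.toℚᵘ-fromℚᵘ (ℚᵘ.mkℚᵘ (+ d) n)) (ℚ.toℚᵘ-fromℚᵘ (ℚᵘ.mkℚᵘ (+ suc n) 0)))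
      (ℚᵘ.≃-trans (ℚᵘ.*≡* (ℤ.*-assoc (+ d) (+ suc n) (+ 1)))
        (ℚᵘ.≃-sym (ℚ.toℚᵘ-fromℚᵘ (ℚᵘ.mkℚᵘ (+ d) 0)))))))))

unit≤1 : ∀ k → fromℚ (unit k) ≤ 1ℝ
unit≤1 k = begin
  u                        ≈⟨ ≃-sym (*-identityʳ u) ⟩
  u * 1ℝ                   ≤⟨ *-monoˡ-≤ (fromℚ-mono-≤ (0≤grid k 1)) (fromℕ-mono-≤ {1} {suc k} (ℕ.s≤s ℕ.z≤n)) ⟩
  u * fromℕ (suc k)        ≈⟨ unit-inverse k ⟩
  1ℝ                       ∎
  where u = fromℚ (unit k)

0<unit : ∀ k → 0ℝ < fromℚ (unit k)
0<unit k = fromℚ-mono-< (ℚ.toℚᵘ-cancel-< (ℚᵘ.<-respʳ-≃ (ℚᵘ.≃-sym (grid-toℚᵘ k 1)) (ℚᵘ.*<* (ℤ.+<+ (ℕ.s≤s ℕ.z≤n)))))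

-- The error term o(1) and the deterministic discrepancy inequality

shrink : ℕ → ℝ
shrink r = 1ℝ - fromℚ (unit r)

0≤shrink : ∀ r → 0ℝ ≤ shrink r
0≤shrink r = ≤⇒0≤- (unit≤1 r)

shrink<1 : ∀ r → shrink r < 1ℝ
shrink<1 r = 0<-⇒< (<-≤-trans (0<unit r)
  (≃⇒≤ (solve 1 (λ u → u := con 1ℚ :- (con 1ℚ :- u)) ≃-refl (fromℚ (unit r)))))

shrink-suc : ∀ r → shrink r * fromℕ (suc r) ≃ fromℕ r
shrink-suc r = begin-equality
  (1ℝ - u) * fromℕ (suc r)             ≈⟨ solve 2 (λ u s → (con 1ℚ :- u) :* s := s :- u :* s) ≃-refl u (fromℕ (suc r)) ⟩
  fromℕ (suc r) - u * fromℕ (suc r)    ≈⟨ +-cong (fromℕ-suc r) (neg-cong (unit-inverse r)) ⟩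
  1ℝ + fromℕ r - 1ℝ                    ≈⟨ solve 1 (λ r → con 1ℚ :+ r :- con 1ℚ := r) ≃-refl (fromℕ r) ⟩
  fromℕ r                              ∎
  where u = fromℚ (unit r)

-- One factor c = shrink r absorbs the error in |A|, the other makes the inequality strict.
slack : ℕ → ℝ
slack r = 1ℝ - shrink r * shrink r


0≤slack : ∀ k → 0ℝ ≤ slack k
0≤slack k = begin
  0ℝ                  ≤⟨ *-nonneg 0≤u (≤⇒0≤- (≤-trans (unit≤1 k) (x≤x+y 0≤1))) ⟩
  u * (1ℝ + 1ℝ - u)
    ≈⟨ solve 1 (λ u → u :* (con 1ℚ :+ con 1ℚ :- u) := con 1ℚ :- (con 1ℚ :- u) :* (con 1ℚ :- u)) ≃-refl u ⟩
  slack k             ∎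
  where
  u = fromℚ (unit k)
  0≤u : 0ℝ ≤ u
  0≤u = <⇒≤ (0<unit k)

slack≤2unit : ∀ k → slack k ≤ fromℚ (unit k) + fromℚ (unit k)
slack≤2unit k = begin
  slack k                        ≤⟨ x≤x+y (0≤square u) ⟩
  slack k + u * u
    ≈⟨ solve 1 (λ u → con 1ℚ :- (con 1ℚ :- u) :* (con 1ℚ :- u) :+ u :* u := u :+ u) ≃-refl u ⟩
  u + u                          ∎
  where u = fromℚ (unit k)

-- A quarter of ε rather than a half: convergence asks for strict inequalities, while
-- `eventually-unit≤` supplies weak ones.
∃δ+δ<ε : ∀ ε → 0ℚ ℚ.< ε → Σ[ δ ∈ ℚ ] (0ℚ ℚ.< δ × δ ℚ.+ δ ℚ.< ε)
∃δ+δ<ε ε 0<ε = ½ ℚ.* (½ ℚ.* ε) , 0<half (0<half 0<ε) ,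
  subst₂ ℚ._<_ (trans (ℚ.+-identityʳ (½ ℚ.* ε)) (sym (half+half (½ ℚ.* ε)))) (half+half ε)
    (ℚ.+-monoʳ-< (½ ℚ.* ε) (0<half 0<ε))

-ε<slack : ∀ ε → 0ℚ ℚ.< ε → ∀ k → 0ℝ - fromℚ ε < slack k
-ε<slack ε 0<ε k = <-≤-trans (0<-⇒< (<-≤-trans (fromℚ-mono-< 0<ε)
  (≃⇒≤ (solve 1 (λ e → e := con 0ℚ :- (con 0ℚ :- e)) ≃-refl (fromℚ ε))))) (0≤slack k)

slack<ε : ∀ ε δ → δ ℚ.+ δ ℚ.< ε → ∀ k → unit k ℚ.≤ δ → slack k < 0ℝ + fromℚ ε
slack<ε ε δ δ+δ<ε k u≤δ = begin-strict
  slack k                              ≤⟨ slack≤2unit k ⟩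
  fromℚ (unit k) + fromℚ (unit k)      ≤⟨ +-mono-≤ (fromℚ-mono-≤ u≤δ) (fromℚ-mono-≤ u≤δ) ⟩
  fromℚ δ + fromℚ δ                    ≈⟨ ≃-sym (fromℚ-+ δ δ) ⟩
  fromℚ (δ ℚ.+ δ)                      <⟨ fromℚ-mono-< δ+δ<ε ⟩
  fromℚ ε                              ≈⟨ ≃-sym (+-identityˡ (fromℚ ε)) ⟩
  0ℝ + fromℚ ε                         ∎

slack⟶0 : (r : ℕ → ℕ) → (∀ K → Eventually (λ n → K ℕ.≤ r n)) → (λ n → slack (r n)) ⟶ 0ℝ
slack⟶0 r r→∞ ε 0<ε = choose (∃δ+δ<ε ε 0<ε)
  where
  Close : ℕ → Set
  Close n = 0ℝ - fromℚ ε < slack (r n) × slack (r n) < 0ℝ + fromℚ ε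
  conclude : ∀ δ → δ ℚ.+ δ ℚ.< ε → Eventually (λ k → unit k ℚ.≤ δ) → Eventually Close
  conclude δ δ+δ<ε (R , small) = eventually₁ {λ n → R ℕ.≤ r n} {Close}
    (λ n R≤r → -ε<slack ε 0<ε (r n) , slack<ε ε δ δ+δ<ε (r n) (small (r n) R≤r)) (r→∞ R)
  choose : Σ[ δ ∈ ℚ ] (0ℚ ℚ.< δ × δ ℚ.+ δ ℚ.< ε) → Eventually Close
  choose (δ , 0<δ , δ+δ<ε) = conclude δ δ+δ<ε (eventually-unit≤ δ 0<δ)

-- With `c = shrink r = r / (r + 1)`, the hypothesis on `a` says `c * (s + 3) < a`, and `s + 3`
-- bounds `(n - d) * p`. Both square roots disappear on squaring `U`, which turns `U ≤ V` into
-- `c * c * (n - d) * p ≤ a` times `a * D * D`.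
discrepancy : ∀ n d M s r a f p .{{_ : NonZero n}} → 0ℝ ≤ p → p < 1ℝ → M ℕ.+ suc d ≡ n →
  fromℕ M * p ≤ fromℕ s + fromℕ 2 → r ℕ.* (s ℕ.+ 3) ℕ.< suc r ℕ.* a → a ℕ.* (d ℕ.+ 1) ℕ.≤ f →
  (1ℝ - slack r) * (1ℝ - p) * √ (1ℝ - fromℚ (+ d ℚ./ n))
    * √ (fromℕ a * fromℕ (d ℕ.+ 1) * (fromℕ n * p) * fromℕ (d ℕ.+ 1))
  < fromℕ f - p * fromℕ a * fromℕ (d ℕ.+ 1)
discrepancy n d M s r a f p 0≤p p<1 n≡ Mp≤ good ad≤f = begin-strict
  (1ℝ - slack r) * (1ℝ - p) * √ x * √ y
    ≈⟨ solve 4 (λ c q x y → (con 1ℚ :- (con 1ℚ :- c :* c)) :* q :* x :* y := c :* (q :* (c :* x :* y)))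
         ≃-refl c (1ℝ - p) (√ x) (√ y) ⟩
  c * ((1ℝ - p) * U)     ≤⟨ *-monoˡ-≤ (0≤shrink r) (*-monoˡ-≤ (<⇒≤ 0<q) U≤V) ⟩
  c * ((1ℝ - p) * V)     ≈⟨ *-comm c ((1ℝ - p) * V) ⟩
  (1ℝ - p) * V * c       <⟨ *-monoˡ-< (*-pos 0<q 0<V) (shrink<1 r) ⟩
  (1ℝ - p) * V * 1ℝ
    ≈⟨ solve 3 (λ p a D → (con 1ℚ :- p) :* (a :* D) :* con 1ℚ := a :* D :- p :* a :* D) ≃-refl p α D ⟩
  V - p * α * D          ≤⟨ +-mono-≤ (≤-trans (≃⇒≤ (≃-sym (fromℕ-* a (d ℕ.+ 1)))) (fromℕ-mono-≤ {a ℕ.* (d ℕ.+ 1)} {f} ad≤f)) ≤-refl ⟩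
  fromℕ f - p * α * D    ∎
  where
  c = shrink r
  α = fromℕ a
  D = fromℕ (d ℕ.+ 1)
  x = 1ℝ - fromℚ (+ d ℚ./ n)
  y = α * D * (fromℕ n * p) * D
  U = c * √ x * √ y
  V = α * D
  0<q : 0ℝ < 1ℝ - p
  0<q = <⇒0<- p<1
  -- The threshold is strict, which rules out an empty A. This matters because `V` must be positive
  -- for `c < 1` to give a strict inequality.
  0<a : 0 ℕ.< a
  0<a = ℕ.n≢0⇒n>0 λ { refl → ℕ.n≮0 (subst (r ℕ.* (s ℕ.+ 3) ℕ.<_) (ℕ.*-zeroʳ (suc r)) good) }
  0<V : 0ℝ < V
  0<V = *-pos (fromℕ-mono-< {0} {a} 0<a) (fromℕ-mono-< {0} {d ℕ.+ 1} (ℕ.m≤n+m 1 d))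
  0<n : 0ℝ < fromℕ n
  0<n = fromℕ-mono-< {0} {n} (ℕ.>-nonZero⁻¹ n)
  xn≃ : x * fromℕ n ≃ fromℕ M + 1ℝ
  xn≃ = begin-equality
    (1ℝ - fromℚ (+ d ℚ./ n)) * fromℕ n
      ≈⟨ solve 2 (λ f n → (con 1ℚ :- f) :* n := n :- f :* n) ≃-refl (fromℚ (+ d ℚ./ n)) (fromℕ n) ⟩
    fromℕ n - fromℚ (+ d ℚ./ n) * fromℕ n
      ≈⟨ +-cong (≃-trans (≃-reflexive (cong fromℕ (sym n≡))) (≃-trans (fromℕ-+ M (suc d)) (+-cong ≃-refl (fromℕ-suc d))))
           (neg-cong (fraction-cancel d n)) ⟩
    fromℕ M + (1ℝ + fromℕ d) - fromℕ d
      ≈⟨ solve 2 (λ m d → m :+ (con 1ℚ :+ d) :- d := m :+ con 1ℚ) ≃-refl (fromℕ M) (fromℕ d) ⟩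
    fromℕ M + 1ℝ  ∎
  0≤x : 0ℝ ≤ x
  0≤x = *-cancelˡ-≤ 0<n (begin
    fromℕ n * 0ℝ     ≈⟨ zeroʳ (fromℕ n) ⟩
    0ℝ               ≤⟨ ≤-trans (0≤fromℕ M) (x≤x+y 0≤1) ⟩
    fromℕ M + 1ℝ     ≈⟨ ≃-trans (≃-sym xn≃) (*-comm x (fromℕ n)) ⟩
    fromℕ n * x      ∎)
  0≤y : 0ℝ ≤ y
  0≤y = *-nonneg (*-nonneg (<⇒≤ 0<V) (*-nonneg (0≤fromℕ n) 0≤p)) (0≤fromℕ (d ℕ.+ 1))
  -- The bound speaks of `n - d = M + 1` vertices while A is drawn from `M`; the extra vertex
  -- contributes `p < 1`, which turns `s + 2` into `s + 3`.
  mean≤ : (fromℕ M + 1ℝ) * p ≤ fromℕ (s ℕ.+ 3)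
  mean≤ = begin
    (fromℕ M + 1ℝ) * p            ≈⟨ solve 2 (λ m p → (m :+ con 1ℚ) :* p := m :* p :+ p) ≃-refl (fromℕ M) p ⟩
    fromℕ M * p + p               ≤⟨ +-mono-≤ Mp≤ (<⇒≤ p<1) ⟩
    fromℕ s + fromℕ 2 + 1ℝ        ≈⟨ +-assoc (fromℕ s) (fromℕ 2) 1ℝ ⟩
    fromℕ s + (fromℕ 2 + 1ℝ)      ≈⟨ +-cong ≃-refl (≃-sym (fromℕ-+ 2 1)) ⟩
    fromℕ s + fromℕ 3             ≈⟨ ≃-sym (fromℕ-+ s 3) ⟩
    fromℕ (s ℕ.+ 3)               ∎
  c*mean≤a : c * fromℕ (s ℕ.+ 3) ≤ α
  c*mean≤a = *-cancelˡ-≤ (fromℕ-mono-< {0} {suc r} (ℕ.s≤s ℕ.z≤n)) (begin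
    fromℕ (suc r) * (c * fromℕ (s ℕ.+ 3))
      ≈⟨ solve 3 (λ R c S → R :* (c :* S) := c :* R :* S) ≃-refl (fromℕ (suc r)) c (fromℕ (s ℕ.+ 3)) ⟩
    c * fromℕ (suc r) * fromℕ (s ℕ.+ 3)    ≈⟨ *-cong (shrink-suc r) ≃-refl ⟩
    fromℕ r * fromℕ (s ℕ.+ 3)              ≈⟨ ≃-sym (fromℕ-* r (s ℕ.+ 3)) ⟩
    fromℕ (r ℕ.* (s ℕ.+ 3))                ≤⟨ fromℕ-mono-≤ {r ℕ.* (s ℕ.+ 3)} {suc r ℕ.* a} (ℕ.<⇒≤ good) ⟩
    fromℕ (suc r ℕ.* a)                    ≈⟨ fromℕ-* (suc r) a ⟩
    fromℕ (suc r) * α                      ∎)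
  U≤V : U ≤ V
  -- Of the two factors `c` in `U * U`, one lowers the mean below `a` and the other is simply
  -- bounded by 1.
  U≤V = square-cancel-≤ 0<V (begin
    U * U
      ≈⟨ solve 3 (λ c x y → (c :* x :* y) :* (c :* x :* y) := c :* c :* ((x :* x) :* (y :* y)))
           ≃-refl c (√ x) (√ y) ⟩
    c * c * ((√ x * √ x) * (√ y * √ y))
      ≈⟨ *-congʳ (*-cong (√-square x 0≤x) (√-square y 0≤y)) ⟩
    c * c * (x * y)
      ≈⟨ solve 6 (λ c x a D n p → c :* c :* (x :* (a :* D :* (n :* p) :* D)) := c :* (c :* (x :* n :* p)) :* (a :* D :* D))
           ≃-refl c x α D (fromℕ n) p ⟩
    c * (c * (x * fromℕ n * p)) * (α * D * D)
      ≈⟨ *-cong (*-congʳ (*-congʳ (*-cong xn≃ ≃-refl))) ≃-refl ⟩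
    c * (c * ((fromℕ M + 1ℝ) * p)) * (α * D * D)
      ≤⟨ *-mono-≤ (*-nonneg 0≤c (*-nonneg 0≤c (*-nonneg (≤-trans (0≤fromℕ M) (x≤x+y 0≤1)) 0≤p))) 0≤aDD
           (*-mono-≤ 0≤c (0≤fromℕ a) (<⇒≤ (shrink<1 r)) (≤-trans (*-monoˡ-≤ 0≤c mean≤) c*mean≤a)) ≤-refl ⟩
    1ℝ * α * (α * D * D)
      ≈⟨ solve 2 (λ a D → con 1ℚ :* a :* (a :* D :* D) := (a :* D) :* (a :* D)) ≃-refl α D ⟩
    V * V  ∎)
    where
    0≤c = 0≤shrink r
    0≤aDD : 0ℝ ≤ α * D * D
    0≤aDD = *-nonneg (<⇒≤ 0<V) (0≤fromℕ (d ℕ.+ 1))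

-- Independent coins

sum-cong : ∀ {n} {f g : Fin n → ℝ} → (∀ i → f i ≃ g i) → sum f ≃ sum g
sum-cong {zero}  h = ≃-refl
sum-cong {suc n} h = +-cong (h zero) (sum-cong (h ∘ suc))

sum-*ˡ : ∀ {n} c (f : Fin n → ℝ) → sum (λ i → c * f i) ≃ c * sum f
sum-*ˡ {zero}  c f = solve 1 (λ c → con 0ℚ := c :* con 0ℚ) ≃-refl c
sum-*ˡ {suc n} c f = begin-equality
  c * f zero + sum (λ i → c * f (suc i))  ≈⟨ +-cong ≃-refl (sum-*ˡ c (f ∘ suc)) ⟩
  c * f zero + c * sum (f ∘ suc)          ≈⟨ ≃-sym (*-distribˡ-+ c _ _) ⟩
  c * (f zero + sum (f ∘ suc))            ∎

sum-++ : ∀ m {n} (f : Fin (m ℕ.+ n) → ℝ) → sum f ≃ sum (f ∘ (_↑ˡ n)) + sum (f ∘ (m ↑ʳ_))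
sum-++ zero    f = ≃-sym (+-identityˡ (sum f))
sum-++ (suc m) f = ≃-trans (+-cong ≃-refl (sum-++ m (f ∘ suc))) (≃-sym (+-assoc _ _ _))

ind : Bool → ℝ
ind b = if b then 1ℝ else 0ℝ

0≤ind : ∀ b → 0ℝ ≤ ind b
0≤ind true  = 0≤1
0≤ind false = ≤-refl

ind-∧ : ∀ a b → ind (a ∧ b) ≃ ind a * ind b
ind-∧ true  b = ≃-sym (*-identityˡ (ind b))
ind-∧ false b = solve 1 (λ x → con 0ℚ := con 0ℚ :* x) ≃-refl (ind b)

ind-not : ∀ b → ind b + ind (not b) ≃ 1ℝ
ind-not true  = solve 0 (con 1ℚ :+ con 0ℚ := con 1ℚ) ≃-refl
ind-not false = solve 0 (con 0ℚ :+ con 1ℚ := con 1ℚ) ≃-refl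

-- This is 2 to the power N, written as a repeated sum so that `splitAt` reads off the first coin.
outcomes : ℕ → ℕ
outcomes zero    = 1
outcomes (suc N) = outcomes N ℕ.+ outcomes N

bits : ∀ {N} → Fin (outcomes N) → Vec Bool N
bits {zero}  ω = []
bits {suc N} ω = [ (λ ω → true ∷ bits ω) , (λ ω → false ∷ bits ω) ]′ (splitAt (outcomes N) ω)

bits-↑ˡ : ∀ {N} (ω : Fin (outcomes N)) → bits {suc N} (ω ↑ˡ outcomes N) ≡ true ∷ bits ω
bits-↑ˡ {N} ω rewrite Fin.splitAt-↑ˡ (outcomes N) ω (outcomes N) = refl

bits-↑ʳ : ∀ {N} (ω : Fin (outcomes N)) → bits {suc N} (outcomes N ↑ʳ ω) ≡ false ∷ bits ω
bits-↑ʳ {N} ω rewrite Fin.splitAt-↑ʳ (outcomes N) (outcomes N) ω = refl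

module Bernoulli (p : ℝ) (0≤p : 0ℝ ≤ p) (p≤1 : p ≤ 1ℝ) where

  bias : Bool → ℝ
  bias b = if b then p else 1ℝ - p

  0≤bias : ∀ b → 0ℝ ≤ bias b
  0≤bias true  = 0≤p
  0≤bias false = ≤⇒0≤- p≤1

  -- Expectation by conditioning on the first coin, so that its properties follow by induction on
  -- the number of coins; `sum≃𝔼` identifies it with the weighted sum over outcomes.
  𝔼 : ∀ {N} → (Vec Bool N → ℝ) → ℝ
  𝔼 {zero}  f = f []
  𝔼 {suc N} f = p * 𝔼 (f ∘ (true ∷_)) + (1ℝ - p) * 𝔼 (f ∘ (false ∷_))

  𝔼-cong : ∀ {N} {f g : Vec Bool N → ℝ} → (∀ v → f v ≃ g v) → 𝔼 f ≃ 𝔼 g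
  𝔼-cong {zero}  h = h []
  𝔼-cong {suc N} h = +-cong (*-congʳ (𝔼-cong (h ∘ (true ∷_)))) (*-congʳ (𝔼-cong (h ∘ (false ∷_))))

  𝔼-mono : ∀ {N} {f g : Vec Bool N → ℝ} → (∀ v → f v ≤ g v) → 𝔼 f ≤ 𝔼 g
  𝔼-mono {zero}  h = h []
  𝔼-mono {suc N} h = +-mono-≤ (*-monoˡ-≤ 0≤p (𝔼-mono (h ∘ (true ∷_))))
                              (*-monoˡ-≤ (0≤bias false) (𝔼-mono (h ∘ (false ∷_))))

  𝔼-+ : ∀ {N} (f g : Vec Bool N → ℝ) → 𝔼 (λ v → f v + g v) ≃ 𝔼 f + 𝔼 g
  𝔼-+ {zero}  f g = ≃-refl
  𝔼-+ {suc N} f g = ≃-trans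
    (+-cong (*-congʳ (𝔼-+ (f ∘ (true ∷_)) (g ∘ (true ∷_)))) (*-congʳ (𝔼-+ (f ∘ (false ∷_)) (g ∘ (false ∷_)))))
    (solve 6 (λ p q a b c d → p :* (a :+ b) :+ q :* (c :+ d) := (p :* a :+ q :* c) :+ (p :* b :+ q :* d))
       ≃-refl p (1ℝ - p) _ _ _ _)

  𝔼-*ˡ : ∀ {N} c (f : Vec Bool N → ℝ) → 𝔼 (λ v → c * f v) ≃ c * 𝔼 f
  𝔼-*ˡ {zero}  c f = ≃-refl
  𝔼-*ˡ {suc N} c f = ≃-trans
    (+-cong (*-congʳ (𝔼-*ˡ c (f ∘ (true ∷_)))) (*-congʳ (𝔼-*ˡ c (f ∘ (false ∷_)))))
    (solve 5 (λ p q c a b → p :* (c :* a) :+ q :* (c :* b) := c :* (p :* a :+ q :* b))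
       ≃-refl p (1ℝ - p) c _ _)

  𝔼-const : ∀ N c → 𝔼 {N} (λ _ → c) ≃ c
  𝔼-const zero    c = ≃-refl
  𝔼-const (suc N) c = ≃-trans (+-cong (*-congʳ (𝔼-const N c)) (*-congʳ (𝔼-const N c)))
    (solve 2 (λ p c → p :* c :+ (con 1ℚ :- p) :* c := c) ≃-refl p c)

  -- Conditioned on coin `r`, the function `g` has the same expectation either way, since
  -- overwriting that coin does not change it. The indicator keeps one of the two branches, of
  -- weight `bias b`.
  𝔼-independent : ∀ {N} (r : Fin N) b (g : Vec Bool N → ℝ) → (∀ v a → g (v [ r ]≔ a) ≃ g v) →
    𝔼 (λ v → ind (does (lookup v r Bool.≟ b)) * g v) ≃ bias b * 𝔼 g
  𝔼-independent zero b g ignores = begin-equality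
    p * 𝔼 (λ v → ind (does (true Bool.≟ b)) * g (true ∷ v))
      + (1ℝ - p) * 𝔼 (λ v → ind (does (false Bool.≟ b)) * g (false ∷ v))
      ≈⟨ +-cong (*-congʳ (𝔼-*ˡ _ (g ∘ (true ∷_))))
          (*-congʳ (≃-trans (𝔼-*ˡ _ (g ∘ (false ∷_))) (*-congʳ (𝔼-cong λ v → ≃-sym (ignores (false ∷ v) true))))) ⟩
    p * (ind (does (true Bool.≟ b)) * x) + (1ℝ - p) * (ind (does (false Bool.≟ b)) * x)
      ≈⟨ pick b ⟩
    bias b * x
      ≈⟨ solve 3 (λ p b x → b :* x := b :* (p :* x :+ (con 1ℚ :- p) :* x)) ≃-refl p (bias b) x ⟩
    bias b * (p * x + (1ℝ - p) * x)
      ≈⟨ *-congʳ (+-cong ≃-refl (*-congʳ (𝔼-cong λ v → ignores (false ∷ v) true))) ⟩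
    bias b * (p * x + (1ℝ - p) * 𝔼 (g ∘ (false ∷_)))  ∎
    where
    x = 𝔼 (g ∘ (true ∷_))
    pick : ∀ b → p * (ind (does (true Bool.≟ b)) * x) + (1ℝ - p) * (ind (does (false Bool.≟ b)) * x) ≃ bias b * x
    pick true  = solve 2 (λ p x → p :* (con 1ℚ :* x) :+ (con 1ℚ :- p) :* (con 0ℚ :* x) := p :* x) ≃-refl p x
    pick false = solve 2 (λ p x → p :* (con 0ℚ :* x) :+ (con 1ℚ :- p) :* (con 1ℚ :* x) := (con 1ℚ :- p) :* x) ≃-refl p x
  𝔼-independent (suc r) b g ignores = ≃-trans
    (+-cong (*-congʳ (𝔼-independent r b (g ∘ (true ∷_)) (λ v a → ignores (true ∷ v) a)))
            (*-congʳ (𝔼-independent r b (g ∘ (false ∷_)) (λ v a → ignores (false ∷ v) a))))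
    (solve 5 (λ p q c a b → p :* (c :* a) :+ q :* (c :* b) := c :* (p :* a :+ q :* b))
       ≃-refl p (1ℝ - p) (bias b) _ _)

  𝔼-marginal : ∀ {N} (r : Fin N) b → 𝔼 (λ v → ind (does (lookup v r Bool.≟ b))) ≃ bias b
  𝔼-marginal {N} r b = begin-equality
    𝔼 (λ v → ind (does (lookup v r Bool.≟ b)))
      ≈⟨ 𝔼-cong (λ v → solve 1 (λ x → x := x :* con 1ℚ) ≃-refl (ind (does (lookup v r Bool.≟ b)))) ⟩
    𝔼 (λ v → ind (does (lookup v r Bool.≟ b)) * 1ℝ)   ≈⟨ 𝔼-independent r b (λ _ → 1ℝ) (λ _ _ → ≃-refl) ⟩
    bias b * 𝔼 {N} (λ _ → 1ℝ)                         ≈⟨ *-congʳ (𝔼-const N 1ℝ) ⟩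
    bias b * 1ℝ                                       ≈⟨ solve 1 (λ x → x :* con 1ℚ := x) ≃-refl (bias b) ⟩
    bias b                                            ∎

  weight : ∀ {N} → Vec Bool N → ℝ
  weight []      = 1ℝ
  weight (b ∷ v) = bias b * weight v

  0≤weight : ∀ {N} (v : Vec Bool N) → 0ℝ ≤ weight v
  0≤weight []      = 0≤1
  0≤weight (b ∷ v) = *-nonneg (0≤bias b) (0≤weight v)

  sum≃𝔼 : ∀ {N} (f : Vec Bool N → ℝ) →
    sum (λ ω → weight (bits {N} ω) * f (bits ω)) ≃ 𝔼 f
  sum≃𝔼 {zero} f = solve 1 (λ x → con 1ℚ :* x :+ con 0ℚ := x) ≃-refl (f [])
  sum≃𝔼 {suc N} f = ≃-trans (sum-++ (outcomes N) (λ ω → g (bits ω)))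
    (+-cong (half true (_↑ˡ outcomes N) bits-↑ˡ) (half false (outcomes N ↑ʳ_) bits-↑ʳ))
    where
    g : Vec Bool (suc N) → ℝ
    g v = weight v * f v
    half : ∀ b (inj : Fin (outcomes N) → Fin (outcomes (suc N))) →
      (∀ ω → bits {suc N} (inj ω) ≡ b ∷ bits ω) →
      sum (λ ω → g (bits (inj ω))) ≃ bias b * 𝔼 (f ∘ (b ∷_))
    half b inj eq = begin-equality
      sum (λ ω → g (bits (inj ω)))
        ≈⟨ sum-cong (λ ω → ≃-trans (≃-reflexive (cong g (eq ω))) (*-assoc (bias b) (weight (bits {N} ω)) (f (b ∷ bits ω)))) ⟩
      sum (λ ω → bias b * (weight (bits {N} ω) * f (b ∷ bits ω)))
        ≈⟨ sum-*ˡ (bias b) (λ ω → weight (bits {N} ω) * f (b ∷ bits ω)) ⟩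
      bias b * sum (λ ω → weight (bits {N} ω) * f (b ∷ bits ω))
        ≈⟨ *-congʳ (sum≃𝔼 (f ∘ (b ∷_))) ⟩
      bias b * 𝔼 (f ∘ (b ∷_))  ∎

  coins : ℕ → FiniteProbabilitySpace
  coins N = record
    { size = outcomes N
    ; weight = λ ω → weight (bits {N} ω)
    ; weight-nonneg = λ ω → 0≤weight (bits {N} ω)
    ; weight-total = begin-equality
        sum (λ ω → weight (bits {N} ω))
          ≈⟨ sum-cong (λ ω → ≃-sym (*-identityʳ (weight (bits {N} ω)))) ⟩
        sum (λ ω → weight (bits {N} ω) * 1ℝ)    ≈⟨ sum≃𝔼 (λ (_ : Vec Bool N) → 1ℝ) ⟩
        𝔼 {N} (λ _ → 1ℝ)                        ≈⟨ 𝔼-const N 1ℝ ⟩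
        1ℝ                                      ∎ }

  Pr≃𝔼 : ∀ N {P : Fin (outcomes N) → Set} (P? : Decidable P) (f : Vec Bool N → Bool) →
    (∀ ω → does (P? ω) ≡ f (bits {N} ω)) → FiniteProbabilitySpace.Pr (coins N) P? ≃ 𝔼 (ind ∘ f)
  Pr≃𝔼 N P? f eq = ≃-trans (sum-cong λ ω → ≃-trans
      (≃-reflexive (cong (λ b → if b then weight (bits {N} ω) else 0ℝ) (eq ω))) (step (weight (bits {N} ω)) (f (bits {N} ω))))
    (sum≃𝔼 {N} (ind ∘ f))
    where
    step : ∀ w b → (if b then w else 0ℝ) ≃ w * ind b
    step w true  = ≃-sym (*-identityʳ w)
    step w false = ≃-sym (zeroʳ w)

  module _ {m : ℕ} where

    -- Only the first `k` coins are counted. In the construction these are the coins of the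
    -- vertices, followed by `m` coins of single pairs.
    hits : ∀ {k} → Subset k → Vec Bool (k ℕ.+ m) → ℕ
    hits {k} S v = ∣ S ∩ take k v ∣

    deviation : ∀ {k} → Subset k → Vec Bool (k ℕ.+ m) → ℝ
    deviation S v = fromℕ (hits S v) - fromℕ ∣ S ∣ * p

    -- The shift a makes the statement inductive without computing the mean separately.
    second-moment : ∀ {k} (S : Subset k) a →
      𝔼 (λ v → (a + deviation S v) * (a + deviation S v)) ≃ a * a + fromℕ ∣ S ∣ * (p * (1ℝ - p))
    second-moment [] a = ≃-trans
      (𝔼-cong {m} λ v → solve 2 (λ a p → (a :+ (con 0ℚ :- con 0ℚ :* p)) :* (a :+ (con 0ℚ :- con 0ℚ :* p)) := a :* a) ≃-refl a p)
      (≃-trans (𝔼-const m (a * a)) (solve 2 (λ a p → a :* a := a :* a :+ con 0ℚ :* (p :* (con 1ℚ :- p))) ≃-refl a p))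
    second-moment {suc k} (false ∷ S) a = begin-equality
      p * x + (1ℝ - p) * x   ≈⟨ solve 2 (λ p x → p :* x :+ (con 1ℚ :- p) :* x := x) ≃-refl p x ⟩
      x                      ≈⟨ second-moment S a ⟩
      a * a + fromℕ ∣ S ∣ * (p * (1ℝ - p))  ∎
      where x = 𝔼 (λ v → (a + deviation S v) * (a + deviation S v))
    second-moment {suc k} (true ∷ S) a = begin-equality
      p * 𝔼 (λ v → (a + deviation (true ∷ S) (true ∷ v)) * (a + deviation (true ∷ S) (true ∷ v)))
        + (1ℝ - p) * 𝔼 (λ v → (a + deviation (true ∷ S) (false ∷ v)) * (a + deviation (true ∷ S) (false ∷ v)))
        -- A head moves the deviation by `1 - p` and a tail by `- p`. The shift absorbs either move,
        -- and the terms linear in `a` cancel because the two moves average to zero.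
        ≈⟨ +-cong (*-congʳ (𝔼-cong λ v → square (heads v))) (*-congʳ (𝔼-cong λ v → square (tails v))) ⟩
      p * 𝔼 (λ v → (a + (1ℝ - p) + deviation S v) * (a + (1ℝ - p) + deviation S v))
        + (1ℝ - p) * 𝔼 (λ v → (a - p + deviation S v) * (a - p + deviation S v))
        ≈⟨ +-cong (*-congʳ (second-moment S (a + (1ℝ - p)))) (*-congʳ (second-moment S (a - p))) ⟩
      p * ((a + (1ℝ - p)) * (a + (1ℝ - p)) + s * (p * (1ℝ - p)))
        + (1ℝ - p) * ((a - p) * (a - p) + s * (p * (1ℝ - p)))
        ≈⟨ solve 3 (λ a p s → let q = con 1ℚ :- p in
             p :* ((a :+ q) :* (a :+ q) :+ s :* (p :* q)) :+ q :* ((a :- p) :* (a :- p) :+ s :* (p :* q))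
             := a :* a :+ (con 1ℚ :+ s) :* (p :* q)) ≃-refl a p s ⟩
      a * a + (1ℝ + s) * (p * (1ℝ - p))
        ≈⟨ +-cong ≃-refl (*-cong (≃-sym (fromℕ-+ 1 ∣ S ∣)) ≃-refl) ⟩
      a * a + fromℕ (suc ∣ S ∣) * (p * (1ℝ - p))  ∎
      where
      s = fromℕ ∣ S ∣
      square : ∀ {x y} → x ≃ y → x * x ≃ y * y
      square h = *-cong h h
      heads : ∀ v → a + deviation (true ∷ S) (true ∷ v) ≃ a + (1ℝ - p) + deviation S v
      heads v = begin-equality
        a + (fromℕ (suc (hits S v)) - fromℕ (suc ∣ S ∣) * p)
          ≈⟨ +-cong ≃-refl (+-cong (fromℕ-+ 1 (hits S v)) (neg-cong (*-cong (fromℕ-+ 1 ∣ S ∣) ≃-refl))) ⟩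
        a + ((1ℝ + fromℕ (hits S v)) - (1ℝ + s) * p)
          ≈⟨ solve 4 (λ a x s p → a :+ ((con 1ℚ :+ x) :- (con 1ℚ :+ s) :* p) := a :+ (con 1ℚ :- p) :+ (x :- s :* p))
               ≃-refl a (fromℕ (hits S v)) s p ⟩
        a + (1ℝ - p) + deviation S v  ∎
      tails : ∀ v → a + deviation (true ∷ S) (false ∷ v) ≃ a - p + deviation S v
      tails v = begin-equality
        a + (fromℕ (hits S v) - fromℕ (suc ∣ S ∣) * p)
          ≈⟨ +-cong ≃-refl (+-cong ≃-refl (neg-cong (*-cong (fromℕ-+ 1 ∣ S ∣) ≃-refl))) ⟩
        a + (fromℕ (hits S v) - (1ℝ + s) * p)
          ≈⟨ solve 4 (λ a x s p → a :+ (x :- (con 1ℚ :+ s) :* p) := a :- p :+ (x :- s :* p))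
               ≃-refl a (fromℕ (hits S v)) s p ⟩
        a - p + deviation S v  ∎

    -- Markov's inequality for the squared deviation, multiplied out to avoid division. The variance
    -- `∣ S ∣ * p * (1 - p)` is relaxed to the mean, for which an integer bound is at hand.
    chebyshev : ∀ {k} (S : Subset k) w (bad : Vec Bool (k ℕ.+ m) → Bool) → 0ℝ ≤ w →
      (∀ v → bad v ≡ true → w ≤ - deviation S v) →
      w * w * 𝔼 (ind ∘ bad) ≤ fromℕ ∣ S ∣ * p
    chebyshev {k} S w bad 0≤w h = begin
      w * w * 𝔼 (ind ∘ bad)             ≈⟨ ≃-sym (𝔼-*ˡ (w * w) (ind ∘ bad)) ⟩
      𝔼 (λ v → w * w * ind (bad v))     ≤⟨ 𝔼-mono pointwise ⟩
      𝔼 (λ v → (0ℝ + deviation S v) * (0ℝ + deviation S v))  ≈⟨ second-moment S 0ℝ ⟩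
      0ℝ * 0ℝ + s * (p * (1ℝ - p))
        ≈⟨ solve 2 (λ s p → con 0ℚ :* con 0ℚ :+ s :* (p :* (con 1ℚ :- p)) := s :* p :- s :* (p :* p)) ≃-refl s p ⟩
      s * p - s * (p * p)               ≤⟨ +-mono-≤ ≤-refl (neg-mono-≤ (*-nonneg (0≤fromℕ ∣ S ∣) (*-nonneg 0≤p 0≤p))) ⟩
      s * p - 0ℝ                        ≈⟨ solve 2 (λ s p → s :* p :- con 0ℚ := s :* p) ≃-refl s p ⟩
      s * p                             ∎
      where
      s = fromℕ ∣ S ∣
      pointwise : ∀ v → w * w * ind (bad v) ≤ (0ℝ + deviation S v) * (0ℝ + deviation S v)
      pointwise v with bad v in eq
      ... | true  = begin
        w * w * 1ℝ                             ≈⟨ *-identityʳ (w * w) ⟩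
        w * w                                  ≤⟨ *-mono-≤ 0≤w (≤-trans 0≤w (h v eq)) (h v eq) (h v eq) ⟩
        - deviation S v * - deviation S v
          ≈⟨ solve 1 (λ x → (:- x) :* (:- x) := (con 0ℚ :+ x) :* (con 0ℚ :+ x)) ≃-refl (deviation S v) ⟩
        (0ℝ + deviation S v) * (0ℝ + deviation S v)  ∎
      ... | false = ≤-trans (≃⇒≤ (zeroʳ (w * w))) (0≤square (0ℝ + deviation S v))

-- The random graph

module Construction (n d : ℕ) where

  N : ℕ
  N = n ℕ.+ n ℕ.* n

  Crossing : Fin n → Fin n → Set
  Crossing i j = toℕ i ℕ.≤ d × d ℕ.< toℕ j

  crossing? : ∀ i j → Dec (Crossing i j)
  crossing? i j = (toℕ i ℕ.≤? d) ×-dec (d ℕ.<? toℕ j)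

  coin : Fin n → Fin n → Fin N
  coin i j = if does (crossing? i j) then j ↑ˡ (n ℕ.* n) else n ↑ʳ combine i j

  coin-crossing : ∀ {i j} → Crossing i j → coin i j ≡ j ↑ˡ (n ℕ.* n)
  coin-crossing {i} {j} c = cong (if_then j ↑ˡ (n ℕ.* n) else n ↑ʳ combine i j) (dec-true (crossing? i j) c)

  coin-other : ∀ {i j} → ¬ Crossing i j → coin i j ≡ n ↑ʳ combine i j
  coin-other {i} {j} ¬c = cong (if_then j ↑ˡ (n ℕ.* n) else n ↑ʳ combine i j) (dec-false (crossing? i j) ¬c)

  -- `coin` is not symmetric in its arguments, so adjacency sorts the two vertices before looking up
  -- their coin.
  graph : Vec Bool N → SimpleGraph n
  graph v = record { adjacent = adj ; symmetric = adj-sym ; loopless = adj-irrefl }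
    where
    adj : Fin n → Fin n → Bool
    adj i j with Fin.<-cmp i j
    ... | tri< _ _ _ = lookup v (coin i j)
    ... | tri≈ _ _ _ = false
    ... | tri> _ _ _ = lookup v (coin j i)
    adj-sym : ∀ i j → adj i j ≡ adj j i
    adj-sym i j with Fin.<-cmp i j | Fin.<-cmp j i
    ... | tri< _ _ _   | tri> _ _ _   = refl
    ... | tri≈ _ _ _   | tri≈ _ _ _   = refl
    ... | tri> _ _ _   | tri< _ _ _   = refl
    ... | tri< _ _ ¬gt | tri< lt _ _  = contradiction lt ¬gt
    ... | tri< _ ¬eq _ | tri≈ _ eq _  = contradiction (sym eq) ¬eq
    ... | tri≈ _ eq _  | tri< _ ¬eq _ = contradiction (sym eq) ¬eq
    ... | tri≈ _ eq _  | tri> _ ¬eq _ = contradiction (sym eq) ¬eq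
    ... | tri> _ ¬eq _ | tri≈ _ eq _  = contradiction (sym eq) ¬eq
    ... | tri> ¬lt _ _ | tri> _ _ gt  = contradiction gt ¬lt
    adj-irrefl : ∀ i → adj i i ≡ false
    adj-irrefl i with Fin.<-cmp i i
    ... | tri< _ ¬eq _ = contradiction refl ¬eq
    ... | tri≈ _ _ _   = refl
    ... | tri> _ ¬eq _ = contradiction refl ¬eq

  adjacent-< : ∀ v {i j} → i Fin.< j → SimpleGraph.adjacent (graph v) i j ≡ lookup v (coin i j)
  adjacent-< v {i} {j} i<j with Fin.<-cmp i j
  ... | tri< _ _ _   = refl
  ... | tri≈ ¬lt _ _ = contradiction i<j ¬lt
  ... | tri> ¬lt _ _ = contradiction i<j ¬lt

  -- The first `n` coins already form a `Subset n`: entry j is the coin of vertex j.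
  A : Vec Bool N → Subset n
  A v = later n d ∩ take n v

  B : Subset n
  B = ∁ (later n d)

  m : ℕ
  m = length (pairs n)

  pair : Fin m → Fin n × Fin n
  pair = List.lookup (pairs n)

  coinOf : Fin m → Fin N
  coinOf k = coin (proj₁ (pair k)) (proj₂ (pair k))

  edge : Vec Bool N → Fin m → Bool
  edge v k = SimpleGraph.adjacent (graph v) (proj₁ (pair k)) (proj₂ (pair k))

  edge≡coin : ∀ v k → edge v k ≡ lookup v (coinOf k)
  -- The filter that defines `pairs` certifies that the first vertex of each pair is the smaller
  -- one.
  edge≡coin v k = adjacent-< v (All.lookup (all-filter _ (cartesianProduct (allFin n) (allFin n))) (∈-lookup k))

  pair-injective : ∀ {k l} → pair k ≡ pair l → k ≡ l
  pair-injective {k} {l} = lookup-injective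
    (Unique.filter⁺ _ (Unique.cartesianProduct⁺ (Unique.allFin⁺ n) (Unique.allFin⁺ n))) k l

  -- On the pairs sharing a coin this distinguishes them: a crossing pair is
  -- determined by its coin and its first vertex, another pair by its coin alone.
  rank : Fin n × Fin n → Fin (suc d)
  rank (i , j) with toℕ i ℕ.≤? d
  ... | yes i≤d = fromℕ< (ℕ.s≤s i≤d)
  ... | no  _   = zero

  ↑ˡ≢↑ʳ : ∀ {a b} {i : Fin a} {j : Fin b} → i ↑ˡ b ≢ a ↑ʳ j
  ↑ˡ≢↑ʳ {a} {b} {i} {j} eq = case trans (sym (Fin.splitAt-↑ˡ a i b))
    (trans (cong (splitAt a) eq) (Fin.splitAt-↑ʳ a b j)) of λ ()

  toℕ-rank : ∀ {i} j → toℕ i ℕ.≤ d → toℕ (rank (i , j)) ≡ toℕ i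
  toℕ-rank {i} j i≤d with toℕ i ℕ.≤? d
  ... | yes p = Fin.toℕ-fromℕ< (ℕ.s≤s p)
  ... | no ¬p = contradiction i≤d ¬p

  coin-rank-injective : ∀ i j i′ j′ → coin i j ≡ coin i′ j′ → rank (i , j) ≡ rank (i′ , j′) →
    (i , j) ≡ (i′ , j′)
  coin-rank-injective i j i′ j′ e r with crossing? i j | crossing? i′ j′
  ... | yes c | yes c′ = cong₂ _,_
    (Fin.toℕ-injective (trans (sym (toℕ-rank j (proj₁ c))) (trans (cong toℕ r) (toℕ-rank j′ (proj₁ c′)))))
    (Fin.↑ˡ-injective _ j j′ (trans (sym (coin-crossing c)) (trans e (coin-crossing c′))))
  ... | yes c | no ¬c′ = contradiction (trans (sym (coin-crossing c)) (trans e (coin-other ¬c′))) ↑ˡ≢↑ʳ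
  ... | no ¬c | yes c′ = contradiction (trans (sym (coin-crossing c′)) (trans (sym e) (coin-other ¬c))) ↑ˡ≢↑ʳ
  ... | no ¬c | no ¬c′ =
    let eq = Fin.combine-injective i j i′ j′
               (Fin.↑ʳ-injective n _ _ (trans (sym (coin-other ¬c)) (trans e (coin-other ¬c′))))
    in cong₂ _,_ (proj₁ eq) (proj₂ eq)

  dependency : SimpleGraph m
  dependency = record
    { adjacent  = λ k l → does (dependent? k l)
    ; symmetric = λ k l → does-⇔ (mk⇔ swap swap) (dependent? k l) (dependent? l k)
    ; loopless  = λ k → dec-false (dependent? k k) (λ (k≢k , _) → k≢k refl) }
    where
    dependent? : ∀ k l → Dec (k ≢ l × coinOf k ≡ coinOf l)
    dependent? k l = ¬? (k Fin.≟ l) ×-dec (coinOf k Fin.≟ coinOf l)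
    swap : ∀ {k l} → k ≢ l × coinOf k ≡ coinOf l → l ≢ k × coinOf l ≡ coinOf k
    swap (k≢l , eq) = ≢-sym k≢l , sym eq

  independent⇒coin≢ : ∀ {k l} → l ≢ k → SimpleGraph.adjacent dependency k l ≡ false →
    coinOf l ≢ coinOf k
  independent⇒coin≢ {k} {l} l≢k eq same = case trans (sym eq)
    (dec-true (¬? (k Fin.≟ l) ×-dec (coinOf k Fin.≟ coinOf l)) (≢-sym l≢k , sym same)) of λ ()

  -- `rank` injects the pairs with the coin of `k` into `Fin (suc d)`, so there are at most d + 1 of
  -- them. One is `k` itself, which leaves at most d neighbours.
  dependency-degree : MaxDegree≤ dependency d
  dependency-degree k = ℕ.s≤s⁻¹ (ℕ.≤-trans
    (ℕ.s≤s (p⊆q⇒∣p∣≤∣q∣ neighbours⊆))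
    (ℕ.≤-trans (x∈p⇒∣p-x∣<∣p∣ (∈-tabulate⁺ same? refl))
      (injection⇒∣p∣≤k sameCoin (λ {l} _ → rank (pair l)) λ {x} {y} x∈ y∈ e →
        pair-injective (coin-rank-injective _ _ _ _
          (trans (sym (∈-tabulate⁻ same? x∈)) (∈-tabulate⁻ same? y∈)) e))))
    where
    same? : Decidable (λ l → coinOf k ≡ coinOf l)
    same? l = coinOf k Fin.≟ coinOf l
    sameCoin : Subset m
    sameCoin = tabulate (does ∘ same?)
    neighbours⊆ : SimpleGraph.neighbours dependency k Subset.⊆ (sameCoin Subset.- k)
    neighbours⊆ {l} l∈ = let k≢l , eq = ∈-tabulate⁻ (λ l → ¬? (k Fin.≟ l) ×-dec same? l) l∈
      in x∈p∧x≢y⇒x∈p-y (∈-tabulate⁺ same? eq) (≢-sym k≢l)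

  take-∈ : ∀ {k j} {i : Fin k} (v : Vec Bool (k ℕ.+ j)) → i ∈ take k v → lookup v (i ↑ˡ j) ≡ true
  take-∈ {suc k} (b ∷ v) here       = refl
  take-∈ {suc k} (b ∷ v) (there i∈) = take-∈ v i∈

  A-B-complete : ∀ v {a b} → a ∈ A v → b ∈ B → SimpleGraph.adjacent (graph v) a b ≡ true
  A-B-complete v {a} {b} a∈A b∈B = trans (SimpleGraph.symmetric (graph v) a b)
    (trans (adjacent-< v (ℕ.≤-<-trans b≤d d<a))
      (trans (cong (lookup v) (coin-crossing (b≤d , d<a))) (take-∈ v (proj₂ split))))
    where
    split = x∈p∩q⁻ (later n d) (take n v) a∈A
    d<a : d ℕ.< toℕ a
    d<a = ∈-tabulate⁻ (λ j → d ℕ.<? toℕ j) (proj₁ split)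
    b≤d : toℕ b ℕ.≤ d
    b≤d = ℕ.≮⇒≥ λ d<b → x∈∁p⇒x∉p b∈B (∈-tabulate⁺ (λ j → d ℕ.<? toℕ j) d<b)

  module _ (p : ℝ) (0≤p : 0ℝ ≤ p) (p≤1 : p ≤ 1ℝ) where

    open Bernoulli p 0≤p p≤1

    randomGraph : RandomGraph n
    randomGraph = record { space = coins N ; graph = graph ∘ bits }

    edge-distribution : ∀ k b →
      FiniteProbabilitySpace.Pr (coins N) (λ ω → edge (bits ω) k Bool.≟ b) ≃ bias b
    edge-distribution k b = ≃-trans
      (Pr≃𝔼 N (λ ω → edge (bits ω) k Bool.≟ b) (λ v → does (lookup v (coinOf k) Bool.≟ b))
        (λ ω → cong (λ x → does (x Bool.≟ b)) (edge≡coin (bits ω) k)))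
      (𝔼-marginal (coinOf k) b)

    module _ (k : Fin m) (c : Fin m → Bool) where

      Rest : Vec Bool N → Set
      Rest v = ∀ l → l ≢ k → SimpleGraph.adjacent dependency k l ≡ false → edge v l ≡ c l

      -- Built exactly as `elsewhere?` is, but on coin vectors, so that the two tests agree by
      -- `refl`.
      rest? : Decidable Rest
      rest? v = Fin.all? λ l →
        ¬? (l Fin.≟ k) →-dec (SimpleGraph.adjacent dependency k l Bool.≟ false) →-dec (edge v l Bool.≟ c l)

      -- The pairs constrained by `Rest` read coins other than that of `k`. This is the invariance
      -- that `𝔼-independent` requires.
      rest-ignores : ∀ v a → does (rest? (v [ coinOf k ]≔ a)) ≡ does (rest? v)
      rest-ignores v a = does-⇔ (mk⇔
        (λ h l l≢k non → trans (sym (unchanged l l≢k non)) (h l l≢k non))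
        (λ h l l≢k non → trans (unchanged l l≢k non) (h l l≢k non)))
        (rest? (v [ coinOf k ]≔ a)) (rest? v)
        where
        unchanged : ∀ l → l ≢ k → SimpleGraph.adjacent dependency k l ≡ false →
          edge (v [ coinOf k ]≔ a) l ≡ edge v l
        unchanged l l≢k non = trans (edge≡coin (v [ coinOf k ]≔ a) l)
          (trans (lookup∘update′ (independent⇒coin≢ l≢k non) v a) (sym (edge≡coin v l)))

    isDependencyGraph : IsDependencyGraph (coins N) (RandomGraph.edge randomGraph) dependency
    isDependencyGraph k b c = begin-equality
      FiniteProbabilitySpace.Pr (coins N) (λ ω → (edge (bits ω) k Bool.≟ b) ×-dec elsewhere ω)
        ≈⟨ Pr≃𝔼 N (λ ω → (edge (bits ω) k Bool.≟ b) ×-dec elsewhere ω) (λ v → does (lookup v (coinOf k) Bool.≟ b) ∧ rest v)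
             (λ ω → cong (λ x → does (x Bool.≟ b) ∧ rest (bits ω)) (edge≡coin (bits ω) k)) ⟩
      𝔼 (λ v → ind (does (lookup v (coinOf k) Bool.≟ b) ∧ rest v))
        ≈⟨ 𝔼-cong (λ v → ind-∧ (does (lookup v (coinOf k) Bool.≟ b)) (rest v)) ⟩
      𝔼 (λ v → ind (does (lookup v (coinOf k) Bool.≟ b)) * ind (rest v))
        ≈⟨ 𝔼-independent (coinOf k) b (ind ∘ rest) (λ v a → ≃-reflexive (cong ind (rest-ignores k c v a))) ⟩
      bias b * 𝔼 (ind ∘ rest)
        ≈⟨ ≃-sym (*-cong (edge-distribution k b) (Pr≃𝔼 N elsewhere rest (λ ω → refl))) ⟩
      FiniteProbabilitySpace.Pr (coins N) (λ ω → edge (bits ω) k Bool.≟ b)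
        * FiniteProbabilitySpace.Pr (coins N) elsewhere  ∎

      where
      rest : Vec Bool N → Bool
      rest v = does (rest? k c v)
      elsewhere : Decidable (Elsewhere (coins N) (RandomGraph.edge randomGraph) dependency k c)
      elsewhere = elsewhere? (coins N) (RandomGraph.edge randomGraph) dependency k c

    isDependentRandomGraph : IsDependentRandomGraph p d randomGraph
    isDependentRandomGraph = record
      { edge-probability = λ k → edge-distribution k true
      ; edge-dependence  = dependency , isDependencyGraph , dependency-degree }

-- Concentration of |A| for a single n

module Concentration (n d s r : ℕ) (p : ℝ) (0≤p : 0ℝ ≤ p) (p≤1 : p ≤ 1ℝ)
  (mean≤ : fromℕ (n ℕ.∸ suc d) * p ≤ fromℕ s + fromℕ 2) (≤mean : fromℕ s ≤ fromℕ (n ℕ.∸ suc d) * p + 1ℝ)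
  where

  open Construction n d
  open Bernoulli p 0≤p p≤1

  mean : ℝ
  mean = fromℕ (n ℕ.∸ suc d) * p

  good? : ∀ (v : Vec Bool N) → Dec (r ℕ.* (s ℕ.+ 3) ℕ.< suc r ℕ.* ∣ A v ∣)
  good? v = r ℕ.* (s ℕ.+ 3) ℕ.<? suc r ℕ.* ∣ A v ∣

  bad : Vec Bool N → Bool
  bad v = not (does (good? v))

  R = fromℕ (suc r)

  0<R : 0ℝ < R
  0<R = fromℕ-mono-< {0} {suc r} (ℕ.s≤s ℕ.z≤n)

  bad⇒≤ : ∀ v → bad v ≡ true → suc r ℕ.* ∣ A v ∣ ℕ.≤ r ℕ.* (s ℕ.+ 3)
  bad⇒≤ v eq = ℕ.≮⇒≥ λ g → case trans (sym eq) (cong not (dec-true (good? v) g)) of λ ()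

  later-mean : fromℕ ∣ later n d ∣ * p ≃ mean
  later-mean = *-cong (≃-reflexive (cong fromℕ (∣later∣ n d))) ≃-refl

  module _ (W : ℕ) (W≡ : W ℕ.+ (1 ℕ.+ 4 ℕ.* r) ≡ s) where

    w : ℝ
    w = fromℚ (unit r) * fromℕ W

    R*w≃W : R * w ≃ fromℕ W
    R*w≃W = begin-equality
      R * (fromℚ (unit r) * fromℕ W)   ≈⟨ solve 3 (λ R u W → R :* (u :* W) := u :* R :* W) ≃-refl R (fromℚ (unit r)) (fromℕ W) ⟩
      fromℚ (unit r) * R * fromℕ W     ≈⟨ *-cong (unit-inverse r) ≃-refl ⟩
      1ℝ * fromℕ W                     ≈⟨ *-identityˡ (fromℕ W) ⟩
      fromℕ W                          ∎

    -- After scaling by `R` this is `bad⇒deviation`; the spare summand `R` there pays for replacing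
    -- `s` by `mean + 1`.
    bad⇒w≤ : ∀ v → bad v ≡ true → w ≤ - deviation (later n d) v
    bad⇒w≤ v eq = *-cancelˡ-≤ 0<R (begin
      R * w                                    ≈⟨ R*w≃W ⟩
      fromℕ W
        ≈⟨ solve 3 (λ W R a → W := W :+ R :* a :+ R :- R :* a :- R) ≃-refl (fromℕ W) R a ⟩
      fromℕ W + R * a + R - R * a - R          ≤⟨ +-mono-≤ (+-mono-≤ W+≤ ≤-refl) ≤-refl ⟩
      R * fromℕ s - R * a - R
        ≤⟨ +-mono-≤ (+-mono-≤ (*-monoˡ-≤ (<⇒≤ 0<R) ≤mean) ≤-refl) ≤-refl ⟩
      R * (mean + 1ℝ) - R * a - R
        ≈⟨ solve 3 (λ R m a → R :* (m :+ con 1ℚ) :- R :* a :- R := R :* (:- (a :- m))) ≃-refl R mean a ⟩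
      R * - (a - mean)                         ≈⟨ *-congʳ (neg-cong (+-cong ≃-refl (neg-cong (≃-sym later-mean)))) ⟩
      R * - deviation (later n d) v            ∎)
      where
      a = fromℕ ∣ A v ∣
      W+≤ : fromℕ W + R * a + R ≤ R * fromℕ s
      W+≤ = begin
        fromℕ W + R * a + R
          ≈⟨ +-cong (+-cong ≃-refl (≃-sym (fromℕ-* (suc r) ∣ A v ∣))) ≃-refl ⟩
        fromℕ W + fromℕ (suc r ℕ.* ∣ A v ∣) + R
          ≈⟨ +-cong (≃-sym (fromℕ-+ W (suc r ℕ.* ∣ A v ∣))) ≃-refl ⟩
        fromℕ (W ℕ.+ suc r ℕ.* ∣ A v ∣) + R
          ≈⟨ ≃-sym (fromℕ-+ (W ℕ.+ suc r ℕ.* ∣ A v ∣) (suc r)) ⟩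
        fromℕ (W ℕ.+ suc r ℕ.* ∣ A v ∣ ℕ.+ suc r)
          ≤⟨ fromℕ-mono-≤ {W ℕ.+ suc r ℕ.* ∣ A v ∣ ℕ.+ suc r} {suc r ℕ.* s}
              (bad⇒deviation W r s ∣ A v ∣ W≡ (bad⇒≤ v eq)) ⟩
        fromℕ (suc r ℕ.* s)                    ≈⟨ fromℕ-* (suc r) s ⟩
        R * fromℕ s                            ∎

    -- Chebyshev's inequality bounds `w * w` times the probability by `s + 2`. Multiplying by
    -- `K * R * R` moves everything to natural numbers, where the hypothesis applies, and `W * W` is
    -- then cancelled.
    bad-bound : ∀ k → 0 ℕ.< W → suc k ℕ.* (suc r ℕ.* suc r ℕ.* (s ℕ.+ 2)) ℕ.≤ W ℕ.* W →
      𝔼 (ind ∘ bad) ≤ fromℚ (unit k)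
    bad-bound k 0<W h = *-cancelˡ-≤ (fromℕ-mono-< {0} {suc k} (ℕ.s≤s ℕ.z≤n)) (begin
      K * P̄                            ≤⟨ *-cancelˡ-≤ (*-pos 0<W′ 0<W′) scaled ⟩
      1ℝ                               ≈⟨ ≃-sym (≃-trans (*-comm K (fromℚ (unit k))) (unit-inverse k)) ⟩
      K * fromℚ (unit k)               ∎)
      where
      K = fromℕ (suc k)
      P̄ = 𝔼 (ind ∘ bad)
      W′ = fromℕ W
      0<W′ : 0ℝ < W′
      0<W′ = fromℕ-mono-< {0} {W} 0<W
      scaled : W′ * W′ * (K * P̄) ≤ W′ * W′ * 1ℝ
      scaled = begin
        W′ * W′ * (K * P̄)              ≈⟨ *-cong (*-cong (≃-sym R*w≃W) (≃-sym R*w≃W)) ≃-refl ⟩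
        R * w * (R * w) * (K * P̄)
          ≈⟨ solve 4 (λ R w K P → R :* w :* (R :* w) :* (K :* P) := K :* (R :* R :* (w :* w :* P))) ≃-refl R w K P̄ ⟩
        K * (R * R * (w * w * P̄))
          ≤⟨ *-monoˡ-≤ (0≤fromℕ (suc k)) (*-monoˡ-≤ (0≤square R)
               (chebyshev (later n d) w bad (*-nonneg (<⇒≤ (0<unit r)) (0≤fromℕ W)) bad⇒w≤)) ⟩
        K * (R * R * (fromℕ ∣ later n d ∣ * p))
          ≤⟨ *-monoˡ-≤ (0≤fromℕ (suc k)) (*-monoˡ-≤ (0≤square R) (≤-trans (≃⇒≤ later-mean) mean≤)) ⟩
        K * (R * R * (fromℕ s + fromℕ 2))
          ≈⟨ *-congʳ (*-cong (≃-sym (fromℕ-* (suc r) (suc r))) (≃-sym (fromℕ-+ s 2))) ⟩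
        K * (fromℕ (suc r ℕ.* suc r) * fromℕ (s ℕ.+ 2))
          ≈⟨ *-congʳ (≃-sym (fromℕ-* (suc r ℕ.* suc r) (s ℕ.+ 2))) ⟩
        K * fromℕ (suc r ℕ.* suc r ℕ.* (s ℕ.+ 2))
          ≈⟨ ≃-sym (fromℕ-* (suc k) (suc r ℕ.* suc r ℕ.* (s ℕ.+ 2))) ⟩
        fromℕ (suc k ℕ.* (suc r ℕ.* suc r ℕ.* (s ℕ.+ 2)))
          ≤⟨ fromℕ-mono-≤ {suc k ℕ.* (suc r ℕ.* suc r ℕ.* (s ℕ.+ 2))} {W ℕ.* W} h ⟩
        fromℕ (W ℕ.* W)                ≈⟨ fromℕ-* W W ⟩
        W′ * W′                        ≈⟨ ≃-sym (*-identityʳ (W′ * W′)) ⟩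
        W′ * W′ * 1ℝ                   ∎

  𝔼-bad≤unit : ∀ k → 33 ℕ.* suc k ℕ.≤ r → cube r ℕ.≤ s → 𝔼 (ind ∘ bad) ≤ fromℚ (unit k)
  𝔼-bad≤unit k 33K≤r r³≤s =
    let W , W≡ , 0<W , h = variance≤deviation² (suc k) r s (ℕ.s≤s ℕ.z≤n) 33K≤r r³≤s
    in bad-bound W W≡ k 0<W h

  goodEvent : Subset (outcomes N)
  goodEvent = tabulate (λ ω → does (good? (bits ω)))

  goodEvent⇒good : ∀ {ω} → ω ∈ goodEvent → r ℕ.* (s ℕ.+ 3) ℕ.< suc r ℕ.* ∣ A (bits ω) ∣
  goodEvent⇒good = ∈-tabulate⁻ (λ ω → good? (bits ω))

  Pr-good : ℝ
  Pr-good = FiniteProbabilitySpace.Pr (coins N) (_∈? goodEvent)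

  Pr-good≃ : Pr-good ≃ 1ℝ - 𝔼 (ind ∘ bad)
  Pr-good≃ = begin-equality
    Pr-good            ≈⟨ Pr≃𝔼 N (_∈? goodEvent) (does ∘ good?)
                            (λ ω → trans (does-∈? ω goodEvent) (lookup∘tabulate (λ ω → does (good? (bits ω))) ω)) ⟩
    G                  ≈⟨ solve 2 (λ g b → g := g :+ b :- b) ≃-refl G (𝔼 (ind ∘ bad)) ⟩
    G + 𝔼 (ind ∘ bad) - 𝔼 (ind ∘ bad)
      ≈⟨ +-cong (≃-trans (≃-sym (𝔼-+ (ind ∘ does ∘ good?) (ind ∘ bad)))
           (≃-trans (𝔼-cong (λ v → ind-not (does (good? v)))) (𝔼-const N 1ℝ))) ≃-refl ⟩
    1ℝ - 𝔼 (ind ∘ bad) ∎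
    where G = 𝔼 (ind ∘ does ∘ good?)

  Pr-good≤1 : Pr-good ≤ 1ℝ
  Pr-good≤1 = begin
    Pr-good               ≈⟨ Pr-good≃ ⟩
    1ℝ - 𝔼 (ind ∘ bad)    ≤⟨ x≤x+y 0≤𝔼 ⟩
    1ℝ - 𝔼 (ind ∘ bad) + 𝔼 (ind ∘ bad)
      ≈⟨ solve 1 (λ b → con 1ℚ :- b :+ b := con 1ℚ) ≃-refl (𝔼 (ind ∘ bad)) ⟩
    1ℝ                    ∎
    where
    0≤𝔼 : 0ℝ ≤ 𝔼 (ind ∘ bad)
    0≤𝔼 = ≤-trans (≃⇒≤ (≃-sym (𝔼-const N 0ℝ))) (𝔼-mono (λ v → 0≤ind (bad v)))

  1-unit≤Pr-good : ∀ k → 33 ℕ.* suc k ℕ.≤ r → cube r ℕ.≤ s → 1ℝ - fromℚ (unit k) ≤ Pr-good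
  1-unit≤Pr-good k h h′ = ≤-trans (+-mono-≤ ≤-refl (neg-mono-≤ (𝔼-bad≤unit k h h′))) (≃⇒≤ (≃-sym Pr-good≃))

-- Limits as n tends to infinity

module Sequences (p : ℕ → ℝ) (d : ℕ → ℕ) (0≤p : ∀ n → 0ℝ ≤ p n) (p<1 : ∀ n → p n < 1ℝ)
  (np⟶∞ : (λ n → fromℕ n * p n) ⟶∞)
  (d< : ∀ n → .{{_ : NonZero n}} → 100 ℕ.* d n ℕ.< 99 ℕ.* n) where

  d<n : ∀ n → .{{_ : NonZero n}} → d n ℕ.< n
  d<n n = ℕ.*-cancelˡ-< 100 (d n) n (ℕ.<-≤-trans (d< n) (ℕ.*-monoˡ-≤ n (ℕ.m≤m+n 99 1)))

  M : ℕ → ℕ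
  M n = n ℕ.∸ suc (d n)

  M+1+d≡n : ∀ n → .{{_ : NonZero n}} → M n ℕ.+ suc (d n) ≡ n
  M+1+d≡n n = ℕ.m∸n+n≡m (d<n n)

  n≤100M+100 : ∀ n → .{{_ : NonZero n}} → n ℕ.≤ 100 ℕ.* M n ℕ.+ 100
  n≤100M+100 n = n≤100m+100 {n} {M n} {d n} (d< n) (M+1+d≡n n)

  bounds : ∀ n → Σ[ s ∈ ℕ ] (fromℕ (M n) * p n ≤ fromℕ s + fromℕ 2 × fromℕ s ≤ fromℕ (M n) * p n + 1ℝ)
  bounds n = integer-bounds (fromℕ (M n) * p n) (*-nonneg (0≤fromℕ (M n)) (0≤p n))

  s : ℕ → ℕ
  s n = proj₁ (bounds n)

  -- The summand 300 consists of 200, from the error 2 in the integer bound on the mean, and 100,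
  -- from the additive term of `n≤100M+100` with `p < 1`.
  np≤100s+300 : ∀ n → .{{_ : NonZero n}} → fromℕ n * p n ≤ fromℕ (100 ℕ.* s n ℕ.+ 300)
  np≤100s+300 n = begin
    fromℕ n * p n
      ≤⟨ *-mono-≤ (0≤fromℕ n) (0≤p n) (fromℕ-mono-≤ {n} {100 ℕ.* M n ℕ.+ 100} (n≤100M+100 n)) ≤-refl ⟩
    fromℕ (100 ℕ.* M n ℕ.+ 100) * p n
      ≈⟨ *-cong (≃-trans (fromℕ-+ (100 ℕ.* M n) 100) (+-cong (fromℕ-* 100 (M n)) ≃-refl)) ≃-refl ⟩
    (H * fromℕ (M n) + H) * p n
      ≈⟨ solve 3 (λ H m p → (H :* m :+ H) :* p := H :* (m :* p) :+ H :* p) ≃-refl H (fromℕ (M n)) (p n) ⟩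
    H * (fromℕ (M n) * p n) + H * p n
      ≤⟨ +-mono-≤ (*-monoˡ-≤ (0≤fromℕ 100) (proj₁ (proj₂ (bounds n)))) (*-monoˡ-≤ (0≤fromℕ 100) (<⇒≤ (p<1 n))) ⟩
    H * (fromℕ (s n) + fromℕ 2) + H * 1ℝ
      ≈⟨ solve 3 (λ H s t → H :* (s :+ t) :+ H :* con 1ℚ := H :* s :+ (H :* t :+ H)) ≃-refl H (fromℕ (s n)) (fromℕ 2) ⟩
    H * fromℕ (s n) + (H * fromℕ 2 + H)
      ≈⟨ +-cong (≃-sym (fromℕ-* 100 (s n))) (≃-trans (+-cong (≃-sym (fromℕ-* 100 2)) ≃-refl) (≃-sym (fromℕ-+ 200 100))) ⟩
    fromℕ (100 ℕ.* s n) + fromℕ 300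
      ≈⟨ ≃-sym (fromℕ-+ (100 ℕ.* s n) 300) ⟩
    fromℕ (100 ℕ.* s n ℕ.+ 300)  ∎
    where H = fromℕ 100

  s→∞ : ∀ K → Eventually (λ n → K ℕ.≤ s n)
  -- The second condition discards n = 0, where the bound on `d` is not assumed.
  s→∞ K = eventually₂ large (np⟶∞ (100 ℕ.* K ℕ.+ 300)) (1 , λ _ 1≤n → 1≤n)
    where
    large : ∀ n → fromℕ (100 ℕ.* K ℕ.+ 300) < fromℕ n * p n → 1 ℕ.≤ n → K ℕ.≤ s n
    large n@(suc _) h _ = ℕ.*-cancelˡ-≤ 100 (ℕ.+-cancelʳ-≤ 300 (100 ℕ.* K) (100 ℕ.* s n)
      (ℕ.<⇒≤ (fromℕ-cancel-< {100 ℕ.* K ℕ.+ 300} {100 ℕ.* s n ℕ.+ 300} (<-≤-trans h (np≤100s+300 n)))))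

  r : ℕ → ℕ
  r n = cbrt (s n)

  r→∞ : ∀ K → Eventually (λ n → K ℕ.≤ r n)
  r→∞ K = eventually₁ (λ n → cube≤⇒≤cbrt) (s→∞ (cube K))

  module C n = Concentration n (d n) (s n) (r n) (p n) (0≤p n) (<⇒≤ (p<1 n))
    (proj₁ (proj₂ (bounds n))) (proj₂ (proj₂ (bounds n)))

  G : ∀ n → RandomGraph n
  G n = Construction.randomGraph n (d n) (p n) (0≤p n) (<⇒≤ (p<1 n))

  -- Each ε needs just one `k` with `unit k < ε`: the failure probability is at most `unit k` as
  -- soon as `r n` reaches `33 * suc k`, so the speed of divergence is irrelevant.
  Pr-good⟶1 : C.Pr-good ⟶ 1ℝ
  Pr-good⟶1 ε 0<ε = choose (∃δ+δ<ε ε 0<ε)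
    where
    Close : ℕ → Set
    Close n = 1ℝ - fromℚ ε < C.Pr-good n × C.Pr-good n < 1ℝ + fromℚ ε
    below : ∀ k → unit k ℚ.< ε → ∀ n → 33 ℕ.* suc k ℕ.≤ r n → 1ℝ - fromℚ ε < C.Pr-good n
    below k u<ε n large = <-≤-trans (-‿anti-< (fromℚ-mono-< u<ε)) (C.1-unit≤Pr-good n k large (cube-cbrt≤ (s n)))
      where
      -‿anti-< : ∀ {x y} → x < y → 1ℝ - y < 1ℝ - x
      -‿anti-< {x} {y} x<y = 0<-⇒< (<-≤-trans (<⇒0<- x<y)
        (≃⇒≤ (solve 2 (λ x y → y :- x := (con 1ℚ :- x) :- (con 1ℚ :- y)) ≃-refl x y)))
    above : ∀ n → C.Pr-good n < 1ℝ + fromℚ ε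
    above n = ≤-<-trans (C.Pr-good≤1 n) (0<-⇒< (<-≤-trans (fromℚ-mono-< 0<ε)
      (≃⇒≤ (solve 1 (λ e → e := con 1ℚ :+ e :- con 1ℚ) ≃-refl (fromℚ ε)))))
    conclude : ∀ k → unit k ℚ.< ε → Eventually Close
    conclude k u<ε = eventually₁ {λ n → 33 ℕ.* suc k ℕ.≤ r n} {Close}
      (λ n large → below k u<ε n large , above n) (r→∞ (33 ℕ.* suc k))
    choose : Σ[ δ ∈ ℚ ] (0ℚ ℚ.< δ × δ ℚ.+ δ ℚ.< ε) → Eventually Close
    choose (δ , 0<δ , δ+δ<ε) = small (eventually-unit≤ δ 0<δ)
      where
      small : Eventually (λ k → unit k ℚ.≤ δ) → Eventually Close
      small (k , h) = conclude k (ℚ.≤-<-trans (h k ℕ.≤-refl) (ℚ.<-trans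
        (subst (ℚ._< δ ℚ.+ δ) (ℚ.+-identityʳ δ) (ℚ.+-monoʳ-< δ 0<δ)) δ+δ<ε))

  ∣B∣≡d+1 : ∀ n → .{{_ : NonZero n}} → ∣ Construction.B n (d n) ∣ ≡ d n ℕ.+ 1
  ∣B∣≡d+1 n = trans (∣∁p∣≡n∸∣p∣ (later n (d n))) (trans (cong (n ℕ.∸_) (∣later∣ n (d n)))
    (trans (ℕ.m∸[m∸n]≡n (d<n n)) (ℕ.+-comm 1 (d n))))

  module _ (n : ℕ) .{{_ : NonZero n}} (v : Vec Bool (n ℕ.+ n ℕ.* n)) where

    open Construction n (d n)

    good⇒discrepancy : r n ℕ.* (s n ℕ.+ 3) ℕ.< suc (r n) ℕ.* ∣ A v ∣ →
      (1ℝ - slack (r n)) * (1ℝ - p n) * √ (1ℝ - fromℚ (+ d n ℚ./ n))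
        * √ (fromℕ ∣ A v ∣ * fromℕ ∣ B ∣ * (fromℕ n * p n) * fromℕ (d n ℕ.+ 1))
      < fromℕ (e (graph v) (A v) B) - p n * fromℕ ∣ A v ∣ * fromℕ ∣ B ∣
    good⇒discrepancy good = subst
      (λ b → (1ℝ - slack (r n)) * (1ℝ - p n) * √ (1ℝ - fromℚ (+ d n ℚ./ n))
        * √ (fromℕ ∣ A v ∣ * fromℕ b * (fromℕ n * p n) * fromℕ (d n ℕ.+ 1))
        < fromℕ (e (graph v) (A v) B) - p n * fromℕ ∣ A v ∣ * fromℕ b)
      (sym (∣B∣≡d+1 n))
      (discrepancy n (d n) (M n) (s n) (r n) ∣ A v ∣ (e (graph v) (A v) B) (p n) (0≤p n) (p<1 n)
        (M+1+d≡n n) (proj₁ (proj₂ (bounds n))) good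
        (subst (λ b → ∣ A v ∣ ℕ.* b ℕ.≤ e (graph v) (A v) B) (∣B∣≡d+1 n)
          (∣A∣*∣B∣≤e (graph v) (A v) B (A-B-complete v))))

theorem4 : (p : ℕ → ℝ) (d : ℕ → ℕ) →
    (∀ n → 0ℝ ≤ p n) →
    (∀ n → p n < 1ℝ) →
    (λ n → fromℕ n * p n) ⟶∞ →
    (∀ n → .{{_ : NonZero n}} → 100 ℕ.* d n ℕ.< 99 ℕ.* n) →
    Σ[ G ∈ (∀ n → RandomGraph n) ]
    (∀ n → IsDependentRandomGraph (p n) (d n) (G n)) ×
    (Σ[ o ∈ (ℕ → ℝ) ]
    (o ⟶ 0ℝ) ×
    AlmostSurely G (λ n H →
    Σ[ A ∈ Subset n ] Σ[ B ∈ Subset n ]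
    (1ℝ - o n) * (1ℝ - p n)
    * √ (1ℝ - fromℚ (+ d n ℚ./ n))
    * √ (fromℕ ∣ A ∣ * fromℕ ∣ B ∣ * (fromℕ n * p n) * fromℕ (d n ℕ.+ 1))
    < fromℕ (e H A B) - p n * fromℕ ∣ A ∣ * fromℕ ∣ B ∣))
theorem4 p d 0≤p p<1 np⟶∞ d< =
  G ,
  (λ n → Construction.isDependentRandomGraph n (d n) (p n) (0≤p n) (<⇒≤ (p<1 n))) ,
  (λ n → slack (r n)) ,
  slack⟶0 r r→∞ ,
  C.goodEvent ,
  (λ n ω ω∈ → Construction.A n (d n) (bits ω) , Construction.B n (d n) ,
    good⇒discrepancy n (bits ω) (C.goodEvent⇒good n ω∈)) ,
  Pr-good⟶1
  where open Sequences p d 0≤p p<1 np⟶∞ d<
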